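{- There exists a generically ergodic Polish $\mathbb{Z}$-space $Y$ (namely an invariant dense $G_\delta$ subset of the odometer space) with the following properties: (i) there does not exist an invariant Borel probability measure on $Y$; (ii) there does not exist a non-meager Baire measurable locally weakly wandering subset of $Y$; (iii) there does not exist a Baire measurable countably generated partition of $Y$ into invariant sets, each of which admits a Baire measurable weakly wandering complete section.
   Context: A Polish $\mathbb{Z}$-space is a Polish space with a continuous $\mathbb{Z}$-action; $T$ denotes the action of $1$. The odometer space is the set of all $\alpha\in 2^{\mathbb{N}}$ having infinitely many $0$s and infinitely many $1$s, with the relative topology and the $\mathbb{Z}$-action generated by the odometer transformation $T$ (addition of $1$ with carry to the right: $T$ changes the first $0$ of $\alpha$ to $1$ and all the preceding $1$s to $0$). A Polish $\mathbb{Z}$-space is generically ergodic if every invariant set with the Baire property is meager or comeager. A set is Baire measurable if it has the Baire property. A set $A$ is weakly wandering if there is an infinite $H\subseteq\mathbb{Z}$ with $T^h(A)\cap T^{h'}(A)=\emptyset$ for all distinct $h,h'\in H$; it is locally weakly wandering if for every point $x$, the intersection of $A$ with the orbit of $x$ is weakly wandering. A complete section of an invariant set $P$ is a subset of $P$ that meets every orbit contained in $P$. A partition of $Y$ is Baire measurable countably generated if there is a countable family of Baire measurable subsets of $Y$ such that two points lie in the same piece of the partition if and only if they belong to exactly the same members of the family. -}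

module Defs where

open import Level using (0ℓ) renaming (suc to lsuc)
open import Data.Bool using (Bool; true; false; not; _∧_; _xor_)
open import Data.Bool.Properties using (not-involutive)
open import Data.Empty using (⊥; ⊥-elim)
open import Data.Integer as ℤ using (ℤ; +_; -[1+_])
import Data.Integer.Properties as ℤ
open import Data.List using (List)
import Data.List.Membership.Propositional as List
open import Data.Maybe using (Maybe; just)
open import Data.Nat as ℕ using (ℕ; zero; suc)
import Data.Nat.Properties as ℕ
open import Data.Product using (Σ; ∃; _×_; _,_; proj₁; proj₂)
open import Data.Rational as ℚ using (ℚ; 0ℚ; 1ℚ)
import Data.Rational.Properties as ℚ
open import Data.Sum using (_⊎_; inj₁; inj₂)
open import Data.Unit using (⊤; tt)
open import Function using (id; _∘_; _⇔_; mk⇔; Equivalence)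
open import Relation.Binary using (Setoid)
import Relation.Binary.Construct.On as On
open import Relation.Binary.PropositionalEquality
  using (_≡_; refl; sym; trans; cong; cong₂; subst; _→-setoid_; module ≡-Reasoning)
open import Relation.Nullary using (¬_)
open import Relation.Unary using (Pred)

------------------------------------------------------------------------
-- Subsets of a setoid.  Points of a space are considered up to `_≈_`
-- (there is no function extensionality), so subsets have to respect it.
-- In the presence of excluded middle every predicate, at any level, is
-- equivalent to a `Set`-valued one, so this is the full power set.

open Setoid using (Carrier)

record Subset (X : Setoid 0ℓ 0ℓ) : Set₁ where
  open Setoid X using (_≈_)
  field
    mem  : Pred (Carrier X) 0ℓ
    resp : ∀ {x y} → x ≈ y → mem x → mem y

open Subset public

module _ {X : Setoid 0ℓ 0ℓ} where
  open Setoid X using (_≈_)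

  infix 4 _∈_ _⊆_ _≐_
  infixr 7 _∩_
  infixr 6 _∪_ _△_

  _∈_ : Carrier X → Subset X → Set
  x ∈ A = mem A x

  _⊆_ : Subset X → Subset X → Set
  A ⊆ B = ∀ x → x ∈ A → x ∈ B

  _≐_ : Subset X → Subset X → Set
  A ≐ B = A ⊆ B × B ⊆ A

  ∅ : Subset X
  ∅ = record { mem = λ _ → ⊥ ; resp = λ _ () }

  whole : Subset X
  whole = record { mem = λ _ → ⊤ ; resp = λ _ _ → tt }

  ∁ : Subset X → Subset X
  ∁ A = record
    { mem  = λ x → ¬ x ∈ A
    ; resp = λ x≈y x∉A y∈A → x∉A (resp A (Setoid.sym X x≈y) y∈A)
    }

  _∩_ : Subset X → Subset X → Subset X
  A ∩ B = record
    { mem  = λ x → x ∈ A × x ∈ B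
    ; resp = λ x≈y (a , b) → resp A x≈y a , resp B x≈y b
    }

  _∪_ : Subset X → Subset X → Subset X
  A ∪ B = record
    { mem  = λ x → x ∈ A ⊎ x ∈ B
    ; resp = λ where
        x≈y (inj₁ a) → inj₁ (resp A x≈y a)
        x≈y (inj₂ b) → inj₂ (resp B x≈y b)
    }

  _△_ : Subset X → Subset X → Subset X
  A △ B = (A ∩ ∁ B) ∪ (B ∩ ∁ A)

  ⋃ : {I : Set} → (I → Subset X) → Subset X
  ⋃ A = record
    { mem  = λ x → ∃ λ i → x ∈ A i
    ; resp = λ x≈y (i , a) → i , resp (A i) x≈y a
    }

  ⋂ : {I : Set} → (I → Subset X) → Subset X
  ⋂ A = record
    { mem  = λ x → ∀ i → x ∈ A i
    ; resp = λ x≈y a i → resp (A i) x≈y (a i)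
    }

  Disjoint : Subset X → Subset X → Set
  Disjoint A B = ∀ x → ¬ (x ∈ A × x ∈ B)

  Nonempty : Subset X → Set
  Nonempty A = ∃ λ x → x ∈ A

  preimage : (f : Carrier X → Carrier X) → (∀ {x y} → x ≈ y → f x ≈ f y) →
             Subset X → Subset X
  preimage f f-cong A = record
    { mem  = λ x → f x ∈ A
    ; resp = λ x≈y → resp A (f-cong x≈y)
    }

  image : (Carrier X → Carrier X) → Subset X → Subset X
  image f A = record
    { mem  = λ y → ∃ λ x → x ∈ A × f x ≈ y
    ; resp = λ y≈z (x , a , fx≈y) → x , a , Setoid.trans X fx≈y y≈z
    }

  -- The countable set {e 0, e 1, ...}; `Maybe` allows it to be empty.
  enumerated : (ℕ → Maybe (Carrier X)) → Subset X
  enumerated e = record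
    { mem  = λ x → ∃ λ n → ∃ λ y → e n ≡ just y × y ≈ x
    ; resp = λ x≈z (n , y , eq , y≈x) → n , y , eq , Setoid.trans X y≈x x≈z
    }

------------------------------------------------------------------------
-- Nonnegative reals as (left) Dedekind cuts: x is represented by the set
-- of rationals q with q < x.

record ℝ≥0 : Set₁ where
  field
    below    : Pred ℚ 0ℓ
    negative : ∀ {q} → q ℚ.< 0ℚ → below q
    down     : ∀ {p q} → p ℚ.< q → below q → below p
    open-up  : ∀ {q} → below q → ∃ λ r → q ℚ.< r × below r
    bounded  : ∃ λ b → ∀ {q} → below q → q ℚ.< b

open ℝ≥0 public using (below)

infix 4 _≤ᴿ_ _<ᴿ_ _≃ᴿ_
infixl 6 _+ᴿ_

_≤ᴿ_ : ℝ≥0 → ℝ≥0 → Set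
x ≤ᴿ y = ∀ q → below x q → below y q

_≃ᴿ_ : ℝ≥0 → ℝ≥0 → Set
x ≃ᴿ y = x ≤ᴿ y × y ≤ᴿ x

_<ᴿ_ : ℝ≥0 → ℝ≥0 → Set
x <ᴿ y = ∃ λ q → below y q × ¬ below x q

fromℚ : (q : ℚ) → 0ℚ ℚ.≤ q → ℝ≥0
fromℚ q 0≤q = record
  { below    = ℚ._< q
  ; negative = λ p<0 → ℚ.<-≤-trans p<0 0≤q
  ; down     = ℚ.<-trans
  ; open-up  = λ p<q → let (m , p<m , m<q) = ℚ.<-dense p<q in m , p<m , m<q
  ; bounded  = q , id
  }

0ᴿ 1ᴿ : ℝ≥0
0ᴿ = fromℚ 0ℚ ℚ.≤-refl
1ᴿ = fromℚ 1ℚ (ℚ.nonNegative⁻¹ 1ℚ)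

private
  +-diff : ∀ p r → (p ℚ.+ ℚ.- r) ℚ.+ r ≡ p
  +-diff p r = trans (ℚ.+-assoc p (ℚ.- r) r)
    (trans (cong (p ℚ.+_) (ℚ.+-inverseˡ r)) (ℚ.+-identityʳ p))

  +-diff-< : ∀ {p a} b → p ℚ.< a ℚ.+ b → p ℚ.+ ℚ.- b ℚ.< a
  +-diff-< {p} {a} b p<a+b = subst (p ℚ.+ ℚ.- b ℚ.<_)
    (trans (ℚ.+-assoc a b (ℚ.- b))
      (trans (cong (a ℚ.+_) (ℚ.+-inverseʳ b)) (ℚ.+-identityʳ a)))
    (ℚ.+-monoˡ-< (ℚ.- b) p<a+b)

_+ᴿ_ : ℝ≥0 → ℝ≥0 → ℝ≥0
x +ᴿ y = record
  { below    = λ q → ∃ λ a → ∃ λ b → below x a × below y b × a ℚ.+ b ≡ q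
  ; negative = λ {q} q<0 →
      let (m , q<m , m<0) = ℚ.<-dense q<0
      in q ℚ.+ ℚ.- m , m
         , ℝ≥0.negative x (+-diff-< m (subst (q ℚ.<_) (sym (ℚ.+-identityˡ m)) q<m))
         , ℝ≥0.negative y m<0 , +-diff q m
  ; down     = λ { {p} p<q (a , b , xa , yb , refl) →
      p ℚ.+ ℚ.- b , b , ℝ≥0.down x (+-diff-< b p<q) xa , yb , +-diff p b }
  ; open-up  = λ { (a , b , xa , yb , refl) →
      let (a′ , a<a′ , xa′) = ℝ≥0.open-up x xa
      in a′ ℚ.+ b , ℚ.+-monoˡ-< b a<a′ , a′ , b , xa′ , yb , refl }
  ; bounded  = let (u , x<u) = ℝ≥0.bounded x ; (v , y<v) = ℝ≥0.bounded y in
      u ℚ.+ v , λ { (a , b , xa , yb , refl) → ℚ.+-mono-< (x<u xa) (y<v yb) }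
  }

partialSum : (ℕ → ℝ≥0) → ℕ → ℝ≥0
partialSum f zero    = 0ᴿ
partialSum f (suc n) = partialSum f n +ᴿ f n

-- A series of nonnegative terms converges to the supremum of its partial
-- sums.
_SumsTo_ : (ℕ → ℝ≥0) → ℝ≥0 → Set₁
f SumsTo s = (∀ n → partialSum f n ≤ᴿ s) ×
             (∀ t → (∀ n → partialSum f n ≤ᴿ t) → s ≤ᴿ t)

------------------------------------------------------------------------

record TopologicalSpace : Set₂ where
  field
    setoid     : Setoid 0ℓ 0ℓ
    Open       : Subset setoid → Set₁
    open-cong  : ∀ {U V} → U ≐ V → Open U → Open V
    open-whole : Open whole
    open-∩     : ∀ {U V} → Open U → Open V → Open (U ∩ V)
    open-⋃     : ∀ {I : Set} {U : I → Subset setoid} →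
                 (∀ i → Open (U i)) → Open (⋃ U)

  open Setoid setoid public using (_≈_) renaming (Carrier to Point)

open TopologicalSpace public using (setoid)

module _ (𝒳 : TopologicalSpace) where
  open TopologicalSpace 𝒳 using (Open; open-whole; _≈_)
    renaming (setoid to X)

  Closure : Subset X → Pred (Carrier X) (lsuc 0ℓ)
  Closure A x = ∀ V → Open V → x ∈ V → Nonempty (V ∩ A)

  Dense : Subset X → Set₁
  Dense A = ∀ x → Closure A x

  IsGδ : Subset X → Set₁
  IsGδ A = ∃ λ (U : ℕ → Subset X) → (∀ n → Open (U n)) × A ≐ ⋂ U

  -- The closure has empty interior.
  NowhereDense : Subset X → Set₁
  NowhereDense A = ∀ U → Open U → (∀ x → x ∈ U → Closure A x) → ¬ Nonempty U

  Meager : Subset X → Set₁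
  Meager A = ∃ λ (N : ℕ → Subset X) → (∀ n → NowhereDense (N n)) × A ≐ ⋃ N

  Comeager : Subset X → Set₁
  Comeager A = Meager (∁ A)

  BaireMeasurable : Subset X → Set₁
  BaireMeasurable A = ∃ λ U → Open U × Meager (A △ U)

  data Borel : Subset X → Set₁ where
    borel-open : ∀ {U} → Open U → Borel U
    borel-∁    : ∀ {A} → Borel A → Borel (∁ A)
    borel-⋃    : ∀ {A : ℕ → Subset X} → (∀ n → Borel (A n)) → Borel (⋃ A)
    borel-cong : ∀ {A B} → A ≐ B → Borel A → Borel B

  record BorelProbabilityMeasure : Set₁ where
    field
      μ          : ∀ A → Borel A → ℝ≥0
      μ-cong     : ∀ {A B} (a : Borel A) (b : Borel B) → A ≐ B → μ A a ≃ᴿ μ B b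
      μ-∅        : (e : Borel ∅) → μ ∅ e ≃ᴿ 0ᴿ
      μ-additive : (A : ℕ → Subset X) (a : ∀ n → Borel (A n)) →
                   (∀ m n → ¬ m ≡ n → Disjoint (A m) (A n)) →
                   (λ n → μ (A n) (a n)) SumsTo μ (⋃ A) (borel-⋃ a)
      μ-total    : μ whole (borel-open open-whole) ≃ᴿ 1ᴿ

  record Metric : Set₁ where
    field
      d          : Carrier X → Carrier X → ℝ≥0
      d-cong     : ∀ {x x′ y y′} → x ≈ x′ → y ≈ y′ → d x y ≃ᴿ d x′ y′
      d-zero     : ∀ {x y} → d x y ≃ᴿ 0ᴿ ⇔ x ≈ y
      d-sym      : ∀ x y → d x y ≃ᴿ d y x
      d-triangle : ∀ x y z → d x z ≤ᴿ d x y +ᴿ d y z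

    -- The metric induces the topology.
    Compatible : Set₁
    Compatible = ∀ U → Open U ⇔
      (∀ x → x ∈ U → ∃ λ ε → 0ᴿ <ᴿ ε × (∀ y → d x y <ᴿ ε → y ∈ U))

    Cauchy : (ℕ → Carrier X) → Set₁
    Cauchy s = ∀ ε → 0ᴿ <ᴿ ε →
      ∃ λ N → ∀ m n → N ℕ.≤ m → N ℕ.≤ n → d (s m) (s n) <ᴿ ε

    _ConvergesTo_ : (ℕ → Carrier X) → Carrier X → Set₁
    s ConvergesTo x = ∀ ε → 0ᴿ <ᴿ ε →
      ∃ λ N → ∀ n → N ℕ.≤ n → d (s n) x <ᴿ ε

    Complete : Set₁
    Complete = ∀ s → Cauchy s → ∃ λ x → s ConvergesTo x

  Separable : Set₁
  Separable = ∃ λ e → Dense (enumerated e)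

  CompletelyMetrizable : Set₁
  CompletelyMetrizable = Σ Metric λ ρ → Metric.Compatible ρ × Metric.Complete ρ

  IsPolish : Set₁
  IsPolish = Separable × CompletelyMetrizable

subspace : (𝒳 : TopologicalSpace) → Subset (setoid 𝒳) → TopologicalSpace
subspace 𝒳 A = record
  { setoid     = On.setoid {B = Σ (Carrier X) (_∈ A)} X proj₁
  ; Open       = λ U → ∃ λ V → Open V × (∀ x → x ∈ U ⇔ proj₁ x ∈ V)
  ; open-cong  = λ (U⊆U′ , U′⊆U) (V , oV , eq) → V , oV , λ x →
      mk⇔ (Equivalence.to (eq x) ∘ U′⊆U x) (U⊆U′ x ∘ Equivalence.from (eq x))
  ; open-whole = whole , open-whole , λ _ → mk⇔ id id
  ; open-∩     = λ (V , oV , eq) (V′ , oV′ , eq′) → V ∩ V′ , open-∩ oV oV′ , λ x →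
      mk⇔ (λ (u , u′) → Equivalence.to (eq x) u , Equivalence.to (eq′ x) u′)
          (λ (v , v′) → Equivalence.from (eq x) v , Equivalence.from (eq′ x) v′)
  ; open-⋃     = λ h → ⋃ (proj₁ ∘ h) , open-⋃ (proj₁ ∘ proj₂ ∘ h) , λ x →
      mk⇔ (λ (i , u) → i , Equivalence.to (proj₂ (proj₂ (h i)) x) u)
          (λ (i , v) → i , Equivalence.from (proj₂ (proj₂ (h i)) x) v)
  }
  where open TopologicalSpace 𝒳 renaming (setoid to X)

------------------------------------------------------------------------

-- ℤ is discrete, so continuity of the action amounts to continuity of
-- each `act m`.
record ℤ-Space : Set₂ where
  field
    space : TopologicalSpace

  open TopologicalSpace space public

  field
    act            : ℤ → Point → Point
    act-cong       : ∀ m {x y} → x ≈ y → act m x ≈ act m y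
    act-0          : ∀ x → act (+ 0) x ≈ x
    act-+          : ∀ m n x → act (m ℤ.+ n) x ≈ act m (act n x)
    act-continuous : ∀ m {U} → Open U → Open (preimage (act m) (act-cong m) U)

open ℤ-Space public using (space)

Finite : Pred ℤ 0ℓ → Set
Finite H = ∃ λ (l : List ℤ) → ∀ h → H h → h List.∈ l

module _ (𝒴 : ℤ-Space) where
  open ℤ-Space 𝒴 using (_≈_; act) renaming (setoid to Y; space to 𝒴-space)

  Invariant : Subset Y → Set
  Invariant A = ∀ m x → x ∈ A → act m x ∈ A

  orbit : Carrier Y → Subset Y
  orbit x = record
    { mem  = λ y → ∃ λ m → act m x ≈ y
    ; resp = λ y≈z (m , mx≈y) → m , Setoid.trans Y mx≈y y≈z
    }

  GenericallyErgodic : Set₁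
  GenericallyErgodic = ∀ A → Invariant A → BaireMeasurable 𝒴-space A →
    Meager 𝒴-space A ⊎ Comeager 𝒴-space A

  InvariantMeasure : BorelProbabilityMeasure 𝒴-space → Set₁
  InvariantMeasure M = ∀ m A (a : Borel 𝒴-space A)
    (a′ : Borel 𝒴-space (image (act m) A)) → μ (image (act m) A) a′ ≃ᴿ μ A a
    where open BorelProbabilityMeasure M

  WeaklyWandering : Subset Y → Set₁
  WeaklyWandering A = ∃ λ (H : Pred ℤ 0ℓ) → ¬ Finite H ×
    (∀ h h′ → H h → H h′ → ¬ h ≡ h′ → Disjoint (image (act h) A) (image (act h′) A))

  LocallyWeaklyWandering : Subset Y → Set₁
  LocallyWeaklyWandering A = ∀ x → WeaklyWandering (A ∩ orbit x)

  CompleteSection : Subset Y → Subset Y → Set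
  CompleteSection P C = C ⊆ P × (∀ x → orbit x ⊆ P → Nonempty (C ∩ orbit x))

  record Partition : Set₁ where
    field
      Index    : Set
      piece    : Index → Subset Y
      nonempty : ∀ i → Nonempty (piece i)
      disjoint : ∀ i j → ¬ i ≡ j → Disjoint (piece i) (piece j)
      cover    : ∀ x → ∃ λ i → x ∈ piece i

    SamePiece : Carrier Y → Carrier Y → Set
    SamePiece x y = ∃ λ i → x ∈ piece i × y ∈ piece i

    BaireMeasurablyCountablyGenerated : Set₁
    BaireMeasurablyCountablyGenerated =
      ∃ λ (B : ℕ → Subset Y) → (∀ n → BaireMeasurable 𝒴-space (B n)) ×
        (∀ x y → SamePiece x y ⇔ (∀ n → x ∈ B n ⇔ y ∈ B n))

restrict : (𝒳 : ℤ-Space) (A : Subset (setoid (space 𝒳))) → Invariant 𝒳 A → ℤ-Space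
restrict 𝒳 A inv = record
  { space          = subspace 𝒳-space A
  ; act            = λ m (x , x∈A) → act m x , inv m x x∈A
  ; act-cong       = λ m → act-cong m
  ; act-0          = λ (x , _) → act-0 x
  ; act-+          = λ m n (x , _) → act-+ m n x
  ; act-continuous = λ m (V , oV , eq) →
      preimage (act m) (act-cong m) V , act-continuous m oV , λ (x , x∈A) →
      mk⇔ (Equivalence.to (eq (act m x , inv m x x∈A)))
          (Equivalence.from (eq (act m x , inv m x x∈A)))
  }
  where open ℤ-Space 𝒳 renaming (space to 𝒳-space)

------------------------------------------------------------------------
-- The Cantor space 2^ℕ with the product topology (`false` is 0, `true`
-- is 1).

2^ℕ : Setoid 0ℓ 0ℓ
2^ℕ = ℕ →-setoid Bool

_≈[_]_ : (ℕ → Bool) → ℕ → (ℕ → Bool) → Set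
α ≈[ n ] β = ∀ i → i ℕ.< n → α i ≡ β i

record CantorOpen (U : Subset 2^ℕ) : Set₁ where
  constructor cantorOpen
  field nbhd : ∀ α → α ∈ U → ∃ λ n → ∀ β → α ≈[ n ] β → β ∈ U

Cantor : TopologicalSpace
Cantor = record
  { setoid     = 2^ℕ
  ; Open       = CantorOpen
  ; open-cong  = λ (U⊆V , V⊆U) (cantorOpen u) → cantorOpen λ α α∈V →
      let (n , h) = u α (V⊆U α α∈V) in n , λ β α≈β → U⊆V β (h β α≈β)
  ; open-whole = cantorOpen λ _ _ → 0 , λ _ _ → tt
  ; open-∩     = λ (cantorOpen u) (cantorOpen v) → cantorOpen λ α (α∈U , α∈V) →
      let (m , f) = u α α∈U
          (n , g) = v α α∈V
      in m ℕ.⊔ n , λ β α≈β →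
           f β (λ i i<m → α≈β i (ℕ.<-≤-trans i<m (ℕ.m≤m⊔n m n))) ,
           g β (λ i i<n → α≈β i (ℕ.<-≤-trans i<n (ℕ.m≤n⊔m m n)))
  ; open-⋃     = λ u → cantorOpen λ α (i , α∈U) →
      let (n , h) = CantorOpen.nbhd (u i) α α∈U in n , λ β α≈β → i , h β α≈β
  }

-- `carry α n` says that a 1 is carried into position n, i.e. that α is 1
-- at all positions < n.
carry : (ℕ → Bool) → ℕ → Bool
carry α zero    = true
carry α (suc n) = carry α n ∧ α n

T : (ℕ → Bool) → (ℕ → Bool)
T α n = α n xor carry α n

-- Subtraction of 1 is addition of 1 conjugated by bitwise complement.
T⁻¹ : (ℕ → Bool) → (ℕ → Bool)
T⁻¹ α = not ∘ T (not ∘ α)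

Infinitely : Bool → (ℕ → Bool) → Set
Infinitely b α = ∀ n → ∃ λ m → n ℕ.≤ m × α m ≡ b

odometerSet : Subset 2^ℕ
odometerSet = record
  { mem  = λ α → Infinitely false α × Infinitely true α
  ; resp = λ α≈β (f , t) → transport α≈β f , transport α≈β t
  }
  where
  transport : ∀ {b α β} → (∀ n → α n ≡ β n) → Infinitely b α → Infinitely b β
  transport α≈β inf n = let (m , n≤m , eq) = inf n in m , n≤m , trans (sym (α≈β m)) eq

OdometerTop : TopologicalSpace
OdometerTop = subspace Cantor odometerSet

module OdometerAction where

  carry-local : ∀ n {α β} → α ≈[ n ] β → carry α n ≡ carry β n
  carry-local zero    _ = refl
  carry-local (suc n) h =
    cong₂ _∧_ (carry-local n λ i i<n → h i (ℕ.m<n⇒m<1+n i<n)) (h n ℕ.≤-refl)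

  T-local : ∀ n {α β} → α ≈[ n ] β → T α ≈[ n ] T β
  T-local n h i i<n = cong₂ _xor_ (h i i<n)
    (carry-local i λ j j<i → h j (ℕ.<-trans j<i i<n))

  T⁻¹-local : ∀ n {α β} → α ≈[ n ] β → T⁻¹ α ≈[ n ] T⁻¹ β
  T⁻¹-local n h i i<n = cong not (T-local n (λ j j<n → cong not (h j j<n)) i i<n)

  T-cong : ∀ {α β} → (∀ n → α n ≡ β n) → ∀ n → T α n ≡ T β n
  T-cong h n = T-local (suc n) (λ i _ → h i) n ℕ.≤-refl

  T⁻¹-cong : ∀ {α β} → (∀ n → α n ≡ β n) → ∀ n → T⁻¹ α n ≡ T⁻¹ β n
  T⁻¹-cong h n = cong not (T-cong (cong not ∘ h) n)

  private
    xor-carry : ∀ a c → c ∧ not (a xor c) ≡ c ∧ a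
    xor-carry false false = refl
    xor-carry false true  = refl
    xor-carry true  false = refl
    xor-carry true  true  = refl

    xor-cancel : ∀ a c → not (not (a xor c) xor c) ≡ a
    xor-cancel false false = refl
    xor-cancel false true  = refl
    xor-cancel true  false = refl
    xor-cancel true  true  = refl

    carry-T : ∀ α n → carry (not ∘ T α) n ≡ carry α n
    carry-T α zero    = refl
    carry-T α (suc n) = trans (cong (_∧ not (T α n)) (carry-T α n))
                              (xor-carry (α n) (carry α n))

  T⁻¹T : ∀ α n → T⁻¹ (T α) n ≡ α n
  T⁻¹T α n = trans (cong (λ c → not (not (T α n) xor c)) (carry-T α n))
                   (xor-cancel (α n) (carry α n))

  TT⁻¹ : ∀ α n → T (T⁻¹ α) n ≡ α n
  TT⁻¹ α n = trans (sym (not-involutive (T (T⁻¹ α) n)))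
    (trans (cong not (trans (cong not (T-cong {T⁻¹ α} (λ _ → refl) n)) (T⁻¹T (not ∘ α) n)))
           (not-involutive (α n)))

  private
    ∧-false : ∀ b → b ∧ false ≡ false
    ∧-false false = refl
    ∧-false true  = refl

    xor-false : ∀ b → b xor false ≡ b
    xor-false false = refl
    xor-false true  = refl

    carry-end : ∀ α k → α k ≡ false → ∀ j → carry α (suc k ℕ.+ j) ≡ false
    carry-end α k αk zero    = trans
      (cong (carry α) (ℕ.+-identityʳ (suc k)))
      (trans (cong (carry α k ∧_) αk) (∧-false (carry α k)))
    carry-end α k αk (suc j) = trans
      (cong (carry α) (ℕ.+-suc (suc k) j))
      (cong (_∧ α (suc k ℕ.+ j)) (carry-end α k αk j))

    T-infinitely : ∀ b α → Infinitely false α → Infinitely b α → Infinitely b (T α)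
    T-infinitely b α inf₀ inf n =
      let (k , _ , αk)   = inf₀ 0
          (m , le , αm)  = inf (n ℕ.⊔ suc k)
          carry-m        = trans
            (cong (carry α) (sym (ℕ.m+[n∸m]≡n (ℕ.≤-trans (ℕ.m≤n⊔m n (suc k)) le))))
            (carry-end α k αk (m ℕ.∸ suc k))
      in m , ℕ.≤-trans (ℕ.m≤m⊔n n (suc k)) le ,
         trans (cong (α m xor_) carry-m) (trans (xor-false (α m)) αm)

    not-infinitely : ∀ b α → Infinitely b α → Infinitely (not b) (not ∘ α)
    not-infinitely b α inf n = let (m , n≤m , eq) = inf n in m , n≤m , cong not eq

  T-odometer : ∀ α → α ∈ odometerSet → T α ∈ odometerSet
  T-odometer α (f , t) = T-infinitely false α f f , T-infinitely true α f t

  T⁻¹-odometer : ∀ α → α ∈ odometerSet → T⁻¹ α ∈ odometerSet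
  T⁻¹-odometer α (f , t) =
    let α′          = not ∘ α
        (f′ , t′)   = T-odometer α′ (not-infinitely true α t , not-infinitely false α f)
    in not-infinitely true (T α′) t′ , not-infinitely false (T α′) f′

  actSeq : ℤ → (ℕ → Bool) → (ℕ → Bool)
  actSeq (+ zero)       α = α
  actSeq (+ suc n)      α = T (actSeq (+ n) α)
  actSeq -[1+ zero ]    α = T⁻¹ α
  actSeq -[1+ suc n ]   α = T⁻¹ (actSeq -[1+ n ] α)

  actSeq-local : ∀ m n {α β} → α ≈[ n ] β → actSeq m α ≈[ n ] actSeq m β
  actSeq-local (+ zero)     n h = h
  actSeq-local (+ suc m)    n h = T-local n (actSeq-local (+ m) n h)
  actSeq-local -[1+ zero ]  n h = T⁻¹-local n h
  actSeq-local -[1+ suc m ] n h = T⁻¹-local n (actSeq-local -[1+ m ] n h)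

  actSeq-cong : ∀ m {α β} → (∀ n → α n ≡ β n) → ∀ n → actSeq m α n ≡ actSeq m β n
  actSeq-cong m h n = actSeq-local m (suc n) (λ i _ → h i) n ℕ.≤-refl

  actSeq-odometer : ∀ m α → α ∈ odometerSet → actSeq m α ∈ odometerSet
  actSeq-odometer (+ zero)     α o = o
  actSeq-odometer (+ suc m)    α o = T-odometer _ (actSeq-odometer (+ m) α o)
  actSeq-odometer -[1+ zero ]  α o = T⁻¹-odometer _ o
  actSeq-odometer -[1+ suc m ] α o = T⁻¹-odometer _ (actSeq-odometer -[1+ m ] α o)

  actSeq-suc : ∀ m α n → actSeq (ℤ.suc m) α n ≡ T (actSeq m α) n
  actSeq-suc (+ m)        α n = refl
  actSeq-suc -[1+ zero ]  α n = sym (TT⁻¹ α n)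
  actSeq-suc -[1+ suc m ] α n = sym (TT⁻¹ (actSeq -[1+ m ] α) n)

  actSeq-pred : ∀ m α n → actSeq (ℤ.pred m) α n ≡ T⁻¹ (actSeq m α) n
  actSeq-pred (+ zero)  α n = refl
  actSeq-pred (+ suc m) α n = sym (T⁻¹T (actSeq (+ m) α) n)
  actSeq-pred -[1+ m ]  α n = refl

  actSeq-+ : ∀ i j α n → actSeq (i ℤ.+ j) α n ≡ actSeq i (actSeq j α) n
  actSeq-+ (+ zero) j α n = cong (λ k → actSeq k α n) (ℤ.+-identityˡ j)
  actSeq-+ (+ suc i) j α n = trans
    (cong (λ k → actSeq k α n) (ℤ.suc-+ i j))
    (trans (actSeq-suc (+ i ℤ.+ j) α n) (T-cong (actSeq-+ (+ i) j α) n))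
  actSeq-+ -[1+ zero ] j α n = actSeq-pred j α n
  actSeq-+ -[1+ suc i ] j α n = trans
    (cong (λ k → actSeq k α n) (ℤ.pred-+ -[1+ i ] j))
    (trans (actSeq-pred (-[1+ i ] ℤ.+ j) α n) (T⁻¹-cong (actSeq-+ -[1+ i ] j α) n))

open OdometerAction using (actSeq)

Odometer : ℤ-Space
Odometer = record
  { space          = OdometerTop
  ; act            = λ m (α , o) → actSeq m α , OdometerAction.actSeq-odometer m α o
  ; act-cong       = λ m → OdometerAction.actSeq-cong m
  ; act-0          = λ _ _ → refl
  ; act-+          = λ m n (α , _) → OdometerAction.actSeq-+ m n α
  ; act-continuous = λ m (V , cantorOpen v , eq) →
      preimage (actSeq m) (OdometerAction.actSeq-cong m) V ,
      cantorOpen (λ α α∈ →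
        let (n , h) = v (actSeq m α) α∈
        in n , λ β α≈β → h (actSeq m β) (OdometerAction.actSeq-local m n α≈β)) ,
      λ (α , o) →
        mk⇔ (Equivalence.to (eq (_ , OdometerAction.actSeq-odometer m α o)))
            (Equivalence.from (eq (_ , OdometerAction.actSeq-odometer m α o)))
  }

{-# OPTIONS --safe #-}

-- Say that α has a gap at k if α is 0 on [k , 2k + 2) and 1 at 2k + 2, and
-- let Y consist of the sequences with infinitely many gaps.
--
-- Every point can be moved into every cylinder by some power of T, and the
-- power depends only on a prefix of the point.  With the Baire category
-- theorem for Y this gives generic ergodicity.  If A is comeager in a
-- cylinder of length n, take x with A ∩ [x] comprising all of [x] in that
-- cylinder: among infinitely many h two points T⁻ʰ x have the same first n
-- digits, so one power of T moves both into A, and A ∩ [x] is not weakly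
-- wandering.  In a countably generated partition into invariant sets one
-- piece is comeager, so a complete section of it is not meager.
--
-- Let k be the first gap of x and c a bit.  The zeros of the gap leave room
-- for x to be moved by a power of T to a sequence beginning with
-- 1ᵏ 0 c x₀ ... x₍ₖ₋₁₎, from which k, c and x can be recovered.  Thus Y is
-- equidecomposable with each of two disjoint subsets of itself, and an
-- invariant probability measure would satisfy 1 + 1 ≤ 1.
module Submission where

open import Defs
open import Axiom.ExcludedMiddle using (ExcludedMiddle)
open import Data.Bool using (Bool; true; false; not; if_then_else_; _∧_; _xor_)
open import Data.Bool.Properties using (not-involutive) renaming (_≟_ to _≟ᵇ_)
open import Data.Empty using (⊥; ⊥-elim)
open import Data.Integer as ℤ using (ℤ; +_; -[1+_])
import Data.Integer.Properties as ℤ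
open import Data.List as List using ([]; _++_)
import Data.List.Membership.Propositional as List
open import Data.List.Membership.Propositional.Properties using (∈-++⁺ˡ; ∈-++⁺ʳ)
open import Data.List.Relation.Unary.Any using (here)
open import Data.Maybe using (just)
open import Data.Nat.Coprimality using (1-coprimeTo)
open import Data.Nat as ℕ using (ℕ; zero; suc; z≤n; s≤s; _≤_; _<_; _⊔_)
open import Data.Nat.Induction using (<-rec)
import Data.Nat.Properties as ℕ
open import Data.Product using (Σ; ∃; _×_; _,_; proj₁; proj₂)
open import Data.Rational as ℚ using (ℚ; 0ℚ; 1ℚ; ½)
import Data.Rational.Properties as ℚ
open import Data.Sum using (_⊎_; inj₁; inj₂)
open import Data.Unit using (tt)
open import Function using (_∘_; id; _⇔_; mk⇔; Equivalence)
open import Level using (0ℓ)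
open import Relation.Binary using (Setoid; tri<; tri≈; tri>)
open import Relation.Binary.PropositionalEquality
  using (_≡_; refl; sym; trans; cong; subst; _≗_)
open import Relation.Nullary using (¬_; yes; no; does)
open import Relation.Nullary.Decidable using (dec-true; dec-false; from-yes)
open import Relation.Unary using (Pred)
open OdometerAction

-- Binary sequences and the odometer

Seq : Set
Seq = ℕ → Bool

≈-sym : ∀ {n} {α β : Seq} → α ≈[ n ] β → β ≈[ n ] α
≈-sym h i i<n = sym (h i i<n)

≈-trans : ∀ {n} {α β γ : Seq} → α ≈[ n ] β → β ≈[ n ] γ → α ≈[ n ] γ
≈-trans h h′ i i<n = trans (h i i<n) (h′ i i<n)

≈-≤ : ∀ {m n} {α β : Seq} → m ≤ n → α ≈[ n ] β → α ≈[ m ] β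
≈-≤ m≤n h i i<m = h i (ℕ.<-≤-trans i<m m≤n)

≗⇒≈ : ∀ {n} {α β : Seq} → α ≗ β → α ≈[ n ] β
≗⇒≈ h i _ = h i

infixr 5 _◂_

_◂_ : Bool → Seq → Seq
(b ◂ α) zero    = b
(b ◂ α) (suc n) = α n

tail : Seq → Seq
tail α n = α (suc n)

◂-local : ∀ b {n} {α β : Seq} → α ≈[ n ] β → (b ◂ α) ≈[ n ] (b ◂ β)
◂-local b h zero    _  = refl
◂-local b h (suc i) lt = h i (ℕ.<-trans ℕ.≤-refl lt)

tail-local : ∀ {n} {α β : Seq} → α ≈[ suc n ] β → tail α ≈[ n ] tail β
tail-local h i i<n = h (suc i) (s≤s i<n)

-- Defined by recursion so that `actSeq (+ double m)` unfolds into `m` applications of T².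
double : ℕ → ℕ
double zero    = zero
double (suc n) = suc (suc (double n))

private
  carry-suc : ∀ α n → carry α (suc n) ≡ α 0 ∧ carry (tail α) n
  carry-suc α zero    with α 0
  ... | false = refl
  ... | true  = refl
  carry-suc α (suc n) rewrite carry-suc α n with α 0
  ... | false = refl
  ... | true  = refl

tail-T : ∀ α n → tail (T α) n ≡ (if α 0 then T (tail α) n else tail α n)
tail-T α n rewrite carry-suc α n with α 0 | α (suc n)
... | true  | _     = refl
... | false | true  = refl
... | false | false = refl

head-T : ∀ α → T α 0 ≡ not (α 0)
head-T α with α 0
... | true  = refl
... | false = refl

head-T² : ∀ α → T (T α) 0 ≡ α 0
head-T² α = trans (head-T (T α)) (trans (cong not (head-T α)) (not-involutive (α 0)))

-- T flips the first digit, so exactly one of two consecutive steps carries into the tail.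
tail-T² : ∀ α n → tail (T (T α)) n ≡ T (tail α) n
tail-T² α n with tail-T (T α) n
... | eq rewrite head-T α with α 0 | tail-T α
... | true  | h = trans eq (h n)
... | false | h = trans eq (T-cong h n)

head-double : ∀ m α → actSeq (+ double m) α 0 ≡ α 0
head-double zero    α = refl
head-double (suc m) α = trans (head-T² (actSeq (+ double m) α)) (head-double m α)

tail-double : ∀ m α n → tail (actSeq (+ double m) α) n ≡ actSeq (+ m) (tail α) n
tail-double zero    α n = refl
tail-double (suc m) α n =
  trans (tail-T² (actSeq (+ double m) α) n) (T-cong {β = actSeq (+ m) (tail α)} (tail-double m α) n)

actSeq-T : ∀ m α n → actSeq (+ m) (T α) n ≡ actSeq (+ suc m) α n
actSeq-T zero    α n = refl
actSeq-T (suc m) α n = T-cong (actSeq-T m α) n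

-- The number of steps that take `α` to the first `n` digits of `β`: one
-- step if the first digits differ, and then an even number, because T²
-- acts on the tail as T does.
steps : ℕ → Seq → Seq → ℕ
steps zero    α β = 0
steps (suc n) α β with α 0 ≟ᵇ β 0
... | yes _ = double (steps n (tail α) (tail β))
... | no  _ = suc (double (steps n (tail (T α)) (tail β)))

private
  double-steps : ∀ n (α β : Seq) → α 0 ≡ β 0 → ∀ m →
    actSeq (+ m) (tail α) ≈[ n ] tail β → actSeq (+ double m) α ≈[ suc n ] β
  double-steps n α β eq m h zero    _         = trans (head-double m α) eq
  double-steps n α β eq m h (suc i) (s≤s i<n) = trans (tail-double m α i) (h i i<n)

  ≢⇒not : ∀ {a b : Bool} → ¬ a ≡ b → not a ≡ b
  ≢⇒not {true}  {true}  h = ⊥-elim (h refl)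
  ≢⇒not {true}  {false} h = refl
  ≢⇒not {false} {true}  h = refl
  ≢⇒not {false} {false} h = ⊥-elim (h refl)

steps-reach : ∀ n α β → actSeq (+ steps n α β) α ≈[ n ] β
steps-reach zero    α β i ()
steps-reach (suc n) α β with α 0 ≟ᵇ β 0
... | yes eq = double-steps n α β eq (steps n (tail α) (tail β)) (steps-reach n (tail α) (tail β))
... | no neq = λ i i<n → trans (sym (actSeq-T (double m) α i))
  (double-steps n (T α) β (trans (head-T α) (≢⇒not neq)) m (steps-reach n _ _) i i<n)
  where m = steps n (tail (T α)) (tail β)

-- The first `n` digits of `T α` depend only on those of `α`, so the recursion reads nothing beyond
-- them. The openness of `copyPiece` rests on this.
steps-local : ∀ n {α α′ β β′} → α ≈[ n ] α′ → β ≈[ n ] β′ → steps n α β ≡ steps n α′ β′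
steps-local zero    h h′ = refl
steps-local (suc n) {α} {α′} {β} {β′} h h′
  with α 0 ≟ᵇ β 0 | α′ 0 ≟ᵇ β′ 0
... | yes _  | yes _  = cong double (steps-local n (tail-local h) (tail-local h′))
... | no _   | no _   = cong (suc ∘ double)
  (steps-local n (tail-local (T-local (suc n) h)) (tail-local h′))
... | yes eq | no neq = ⊥-elim (neq (trans (sym (h 0 (s≤s z≤n))) (trans eq (h′ 0 (s≤s z≤n)))))
... | no neq | yes eq = ⊥-elim (neq (trans (h 0 (s≤s z≤n)) (trans eq (sym (h′ 0 (s≤s z≤n))))))

-- Eventual equality along orbits

_∼_ : Seq → Seq → Set
α ∼ β = ∃ λ k → ∀ i → k ≤ i → α i ≡ β i

∼-trans : ∀ {α β γ} → α ∼ β → β ∼ γ → α ∼ γ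
∼-trans (k , h) (l , h′) = k ⊔ l , λ i le →
  trans (h i (ℕ.≤-trans (ℕ.m≤m⊔n k l) le)) (h′ i (ℕ.≤-trans (ℕ.m≤n⊔m k l) le))

private
  carry-stops : ∀ {α k} → α k ≡ false → ∀ {i} → k < i → carry α i ≡ false
  carry-stops {α} {k} αk {suc i} (s≤s k≤i) with ℕ.m≤n⇒m<n∨m≡n k≤i
  ... | inj₁ k<i rewrite carry-stops {α} αk k<i = refl
  ... | inj₂ refl rewrite αk with carry α k
  ... | true  = refl
  ... | false = refl

∼-sym : ∀ {α β} → α ∼ β → β ∼ α
∼-sym (k , h) = k , λ i k≤i → sym (h i k≤i)

-- No carry passes beyond a 0 of `α`.
T-∼ : ∀ α → Infinitely false α → T α ∼ α
T-∼ α inf = let (k , _ , αk) = inf 0 in suc k , λ i k<i →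
  trans (cong (α i xor_) (carry-stops αk k<i)) (xor-false (α i))
  where
  xor-false : ∀ b → b xor false ≡ b
  xor-false true  = refl
  xor-false false = refl

T⁻¹-∼ : ∀ α → Infinitely true α → T⁻¹ α ∼ α
T⁻¹-∼ α inf =
  let (k , h) = T-∼ (not ∘ α) λ n → let (m , le , eq) = inf n in m , le , cong not eq
  in k , λ i k≤i → trans (cong not (h i k≤i)) (not-involutive (α i))

actSeq-∼ : ∀ m α → α ∈ odometerSet → actSeq m α ∼ α
actSeq-∼ (+ zero)     α o = 0 , λ _ _ → refl
actSeq-∼ (+ suc m)    α o =
  ∼-trans (T-∼ _ (proj₁ (actSeq-odometer (+ m) α o))) (actSeq-∼ (+ m) α o)
actSeq-∼ -[1+ zero ]  α o = T⁻¹-∼ α (proj₂ o)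
actSeq-∼ -[1+ suc m ] α o =
  ∼-trans (T⁻¹-∼ _ (proj₂ (actSeq-odometer -[1+ m ] α o))) (actSeq-∼ -[1+ m ] α o)

-- Gaps

-- The `k` digits before a gap and its `k + 2` zeros fill `gapEnd k` positions, the length of 1ᵏ 0 c
-- followed by `k` digits.
gapEnd : ℕ → ℕ
gapEnd k = suc (suc (k ℕ.+ k))

-- The closing 1 supplies the infinitely many 1s of a point of the odometer space.
Gap : ℕ → Seq → Set
Gap k α = (∀ i → k ≤ i → i < gapEnd k → α i ≡ false) × α (gapEnd k) ≡ true

k<gapEnd : ∀ k → k < gapEnd k
k<gapEnd k = s≤s (ℕ.≤-trans (ℕ.m≤m+n k k) (ℕ.n≤1+n _))

gapEnd-mono : ∀ {j k} → j ≤ k → gapEnd j ≤ gapEnd k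
gapEnd-mono j≤k = s≤s (s≤s (ℕ.+-mono-≤ j≤k j≤k))

Gap-local : ∀ k {α β} → α ≈[ suc (gapEnd k) ] β → Gap k α → Gap k β
Gap-local k h (zeros , one) =
  (λ i k≤i i<e → trans (sym (h i (ℕ.m<n⇒m<1+n i<e))) (zeros i k≤i i<e)) ,
  trans (sym (h (gapEnd k) ℕ.≤-refl)) one

-- A gap prescribes every digit from `k` through `gapEnd k`. Hence `k` digits of payload in a code
-- suffice to recover the whole prefix.
Gap-determined : ∀ k {α β} → α ≈[ k ] β → Gap k α → Gap k β → α ≈[ suc (gapEnd k) ] β
Gap-determined k h (zeros , one) (zeros′ , one′) i (s≤s i≤e)
  with ℕ.m≤n⇒m<n∨m≡n i≤e
... | inj₂ refl = trans one (sym one′)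
... | inj₁ i<e with i ℕ.<? k
... | yes i<k = h i i<k
... | no  i≮k = trans (zeros i (ℕ.≮⇒≥ i≮k) i<e) (sym (zeros′ i (ℕ.≮⇒≥ i≮k) i<e))

GapRich : Seq → Set
GapRich α = ∀ n → ∃ λ k → n ≤ k × Gap k α

GapRich-∼ : ∀ {α β} → α ∼ β → GapRich α → GapRich β
GapRich-∼ (l , h) rich n =
  let (k , le , zeros , one) = rich (n ⊔ l)
      l≤k = ℕ.≤-trans (ℕ.m≤n⊔m n l) le
  in k , ℕ.≤-trans (ℕ.m≤m⊔n n l) le ,
     (λ i k≤i i<e → trans (sym (h i (ℕ.≤-trans l≤k k≤i))) (zeros i k≤i i<e)) ,
     trans (sym (h _ (ℕ.≤-trans l≤k (ℕ.<⇒≤ (k<gapEnd k))))) one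

GapRich-odometer : ∀ {α} → GapRich α → α ∈ odometerSet
GapRich-odometer rich =
  (λ n → let (k , n≤k , zeros , _) = rich n in k , n≤k , zeros k ℕ.≤-refl (k<gapEnd k)) ,
  (λ n → let (k , n≤k , _ , one) = rich n in
     gapEnd k , ℕ.≤-trans n≤k (ℕ.<⇒≤ (k<gapEnd k)) , one)

code : ℕ → Bool → Seq → Seq
code zero    c α = false ◂ c ◂ α
code (suc k) c α = true ◂ code k c α

code-local : ∀ k c {n} {α β : Seq} → α ≈[ n ] β → code k c α ≈[ n ] code k c β
code-local zero    c h = ◂-local false (◂-local c h)
code-local (suc k) c h = ◂-local true (code-local k c h)

-- Unary headers of different lengths differ at position min(k, k′), which is below both bounds. The
-- payload lengths `l`, `l′` are separate parameters so that induction on the headers leaves them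
-- fixed.
code-injective : ∀ k k′ l l′ {c c′ α α′} →
  (∀ i → i < suc (suc (k ℕ.+ l)) → i < suc (suc (k′ ℕ.+ l′)) →
     code k c α i ≡ code k′ c′ α′ i) →
  k ≡ k′ × c ≡ c′ × (∀ j → j < l → j < l′ → α j ≡ α′ j)
code-injective zero zero l l′ h =
  refl , h 1 (s≤s (s≤s z≤n)) (s≤s (s≤s z≤n)) ,
  λ j j<l j<l′ → h (suc (suc j)) (s≤s (s≤s j<l)) (s≤s (s≤s j<l′))
code-injective zero (suc k′) l l′ h with () ← h 0 (s≤s z≤n) (s≤s z≤n)
code-injective (suc k) zero l l′ h with () ← h 0 (s≤s z≤n) (s≤s z≤n)
code-injective (suc k) (suc k′) l l′ h =
  let (k≡ , rest) = code-injective k k′ l l′ λ i lt lt′ → h (suc i) (s≤s lt) (s≤s lt′)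
  in cong suc k≡ , rest

-- Countable unions of meager sets

private
  next : ℕ × ℕ → ℕ × ℕ
  next (zero  , b) = suc b , zero
  next (suc a , b) = a , suc b

-- The antidiagonals in turn, each from `(n , 0)` to `(0 , n)`.
unpair : ℕ → ℕ × ℕ
unpair zero    = 0 , 0
unpair (suc n) = next (unpair n)

private
  unpair-diagonal : ∀ b a → (∃ λ n → unpair n ≡ (a ℕ.+ b , 0)) → ∃ λ n → unpair n ≡ (a , b)
  unpair-diagonal zero    a (n , eq) = n , trans eq (cong (_, 0) (ℕ.+-identityʳ a))
  unpair-diagonal (suc b) a (n , eq) =
    let (m , eq′) = unpair-diagonal b (suc a) (n , trans eq (cong (_, 0) (ℕ.+-suc a b)))
    in suc m , cong next eq′

  unpair-axis : ∀ a → ∃ λ n → unpair n ≡ (a , 0)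
  unpair-axis zero    = 0 , refl
  unpair-axis (suc a) =
    let (n , eq) = unpair-diagonal a 0 (unpair-axis a) in suc n , cong next eq

unpair-surjective : ∀ a b → ∃ λ n → unpair n ≡ (a , b)
unpair-surjective a b = unpair-diagonal b a (unpair-axis (a ℕ.+ b))

enumℤ : ℕ → ℤ
enumℤ n = let (a , b) = unpair n in a ℤ.⊖ b

enumℤ-surjective : ∀ i → ∃ λ n → enumℤ n ≡ i
enumℤ-surjective (+ a)    =
  let (n , eq) = unpair-surjective a 0 in n , cong (λ (a , b) → a ℤ.⊖ b) eq
enumℤ-surjective -[1+ b ] =
  let (n , eq) = unpair-surjective 0 (suc b) in n , cong (λ (a , b) → a ℤ.⊖ b) eq

module _ (𝒳 : TopologicalSpace) where
  open TopologicalSpace 𝒳 using (Open) renaming (setoid to X)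

  nowhereDense-⊆ : ∀ {A B : Subset X} → A ⊆ B → NowhereDense 𝒳 B → NowhereDense 𝒳 A
  nowhereDense-⊆ A⊆B nd U oU U⊆clA = nd U oU λ x x∈U V oV x∈V →
    let (z , z∈V , z∈A) = U⊆clA x x∈U V oV x∈V in z , z∈V , A⊆B z z∈A

  meager-⊆ : ∀ {A B : Subset X} → A ⊆ B → Meager 𝒳 B → Meager 𝒳 A
  meager-⊆ {A} A⊆B (N , nd , B⊆N , _) =
    -- `Meager` asks for equality with a union, so the cover is cut down to `A`.
    (λ n → N n ∩ A) , (λ n → nowhereDense-⊆ {N n ∩ A} {N n} (λ _ → proj₁) (nd n)) ,
    (λ x x∈A → let (n , x∈N) = B⊆N x (A⊆B x x∈A) in n , x∈N , x∈A) ,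
    (λ x (n , _ , x∈A) → x∈A)

  meager-⋃ : {I : Set} (e : ℕ → I) → (∀ i → ∃ λ n → e n ≡ i) →
             {M : I → Subset X} → (∀ i → Meager 𝒳 (M i)) → Meager 𝒳 (⋃ M)
  meager-⋃ e e-surj {M} meager =
    N ∘ unpair , (λ n → proj₁ (proj₂ (meager (e (proj₁ (unpair n))))) (proj₂ (unpair n))) ,
    to , from
    where
    N : ℕ × ℕ → Subset X
    N (a , b) = proj₁ (meager (e a)) b
    to : ⋃ M ⊆ ⋃ (N ∘ unpair)
    to x (i , x∈M) with e-surj i
    ... | a , refl =
      let (b , x∈N) = proj₁ (proj₂ (proj₂ (meager (e a)))) x x∈M
          (n , eq)  = unpair-surjective a b
      in n , subst (λ p → x ∈ N p) (sym eq) x∈N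
    from : ⋃ (N ∘ unpair) ⊆ ⋃ M
    from x (n , x∈N) = e a , proj₂ (proj₂ (proj₂ (meager (e a)))) x (_ , x∈N)
      where a = proj₁ (unpair n)

-- Translates and saturations in a ℤ-space

module _ (𝒴 : ℤ-Space) where
  open ℤ-Space 𝒴 using (Open; open-cong; _≈_; act; act-cong; act-0; act-+; act-continuous)
    renaming (setoid to Y; space to 𝒴-space)
  open Setoid Y using () renaming (trans to ≈Y-trans; sym to ≈Y-sym; reflexive to ≈Y-reflexive)

  actPreimage : ℤ → Subset Y → Subset Y
  actPreimage m = preimage (act m) (act-cong m)

  act-neg : ∀ m x → act (ℤ.- m) (act m x) ≈ x
  act-neg m x = ≈Y-trans (≈Y-sym (act-+ (ℤ.- m) m x))
    (≈Y-trans (≈Y-reflexive (cong (λ k → act k x) (ℤ.+-inverseˡ m))) (act-0 x))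

  act-neg′ : ∀ m x → act m (act (ℤ.- m) x) ≈ x
  act-neg′ m x = ≈Y-trans (≈Y-sym (act-+ m (ℤ.- m) x))
    (≈Y-trans (≈Y-reflexive (cong (λ k → act k x) (ℤ.+-inverseʳ m))) (act-0 x))

  -- The image under `act m` is the preimage under its inverse.
  image-open : ∀ m {U} → Open U → Open (image (act m) U)
  image-open m {U} oU = open-cong
    ((λ y y∈ → act (ℤ.- m) y , y∈ , act-neg′ m y) ,
     (λ y (x , x∈U , mx≈y) →
        resp U (≈Y-trans (≈Y-sym (act-neg m x)) (act-cong (ℤ.- m) mx≈y)) x∈U))
    (act-continuous (ℤ.- m) oU)

  nowhereDense-preimage : ∀ m {N} → NowhereDense 𝒴-space N →
                          NowhereDense 𝒴-space (actPreimage m N)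
  nowhereDense-preimage m {N} nd U oU U⊆cl (x , x∈U) =
    nd (actPreimage (ℤ.- m) U) (act-continuous (ℤ.- m) oU)
      (λ y y∈ V oV y∈V →
        let (z , z∈V , z∈N) = U⊆cl _ y∈ (actPreimage m V) (act-continuous m oV)
              (resp V (≈Y-sym (act-neg′ m y)) y∈V)
        in act m z , z∈V , z∈N)
      (act m x , resp U (≈Y-sym (act-neg m x)) x∈U)

  saturation : Subset Y → Subset Y
  saturation A = ⋃ λ m → actPreimage m A

  meager-saturation : ∀ {M} → Meager 𝒴-space M → Meager 𝒴-space (saturation M)
  meager-saturation {M} (N , nd , M⊆N , N⊆M) =
    meager-⋃ 𝒴-space enumℤ enumℤ-surjective {λ m → actPreimage m M} λ m →
    (λ n → actPreimage m (N n)) , (λ n → nowhereDense-preimage m {N n} (nd n)) ,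
    (λ x → M⊆N (act m x)) , (λ x → N⊆M (act m x))

  invariant-reflect : ∀ {A} → Invariant 𝒴 A → ∀ m x → act m x ∈ A → x ∈ A
  invariant-reflect {A} inv m x mx∈A = resp A (act-neg m x) (inv (ℤ.- m) _ mx∈A)

-- Invariant measures

+ᴿ-mono : ∀ {x x′ y y′} → x ≤ᴿ x′ → y ≤ᴿ y′ → x +ᴿ y ≤ᴿ x′ +ᴿ y′
+ᴿ-mono x≤x′ y≤y′ q (a , b , xa , yb , eq) = a , b , x≤x′ a xa , y≤y′ b yb , eq

partialSum-mono : ∀ {f g} → (∀ n → f n ≤ᴿ g n) → ∀ n → partialSum f n ≤ᴿ partialSum g n
partialSum-mono         f≤g zero    = λ _ → id
partialSum-mono {f} {g} f≤g (suc n) =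
  +ᴿ-mono {partialSum f n} {partialSum g n} {f n} {g n} (partialSum-mono f≤g n) (f≤g n)

module _ (em : ∀ {ℓ} → ExcludedMiddle ℓ) (𝒳 : TopologicalSpace)
         (M : BorelProbabilityMeasure 𝒳) where
  open TopologicalSpace 𝒳 using (open-whole) renaming (setoid to X)
  open BorelProbabilityMeasure M

  no-disjoint-full : ∀ {P Q : Subset X} (p : Borel 𝒳 P) (q : Borel 𝒳 Q) → Disjoint P Q →
                     1ᴿ ≤ᴿ μ P p → 1ᴿ ≤ᴿ μ Q q → ⊥
  no-disjoint-full {P} {Q} p q P∩Q=∅ fullP fullQ = ℚ.<-irrefl refl
    (proj₁ μ-total 1ℚ (proj₁ (μ-cong (borel-⋃ a) (borel-open open-whole) A-covers) 1ℚ
      (proj₁ (μ-additive A a A-disjoint) 2 1ℚ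
        -- 1 = ½ + ½ lies below (0 + μ P) + μ Q. In the first summand ½ is split as -¼ + ¾, because
        -- the cut `0ᴿ` contains only negative rationals.
        ( ½ , ½
        , ( ℚ.- (+ 1 ℚ./ 4) , + 3 ℚ./ 4 , from-yes (ℚ.- (+ 1 ℚ./ 4) ℚ.<? 0ℚ)
          , fullP _ (from-yes (+ 3 ℚ./ 4 ℚ.<? 1ℚ)) , refl)
        , fullQ _ (from-yes (½ ℚ.<? 1ℚ)) , refl))))
    where
    PQ : ℕ → Subset X
    PQ zero    = P
    PQ (suc _) = Q

    A : ℕ → Subset X
    A 0 = P
    A 1 = Q
    -- The remainder completes P and Q to a partition of the space, so that `μ-total` applies to the
    -- union.
    A 2 = ∁ (⋃ PQ)
    A (suc (suc (suc _))) = ∅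

    a : ∀ n → Borel 𝒳 (A n)
    a 0 = p
    a 1 = q
    a 2 = borel-∁ (borel-⋃ {A = PQ} λ where zero → p ; (suc _) → q)
    a (suc (suc (suc _))) = borel-cong
      ((λ x x∉whole → x∉whole tt) , λ _ ()) (borel-∁ (borel-open open-whole))

    A-disjoint : ∀ m n → ¬ m ≡ n → Disjoint (A m) (A n)
    A-disjoint 0 0 m≢n x _ = m≢n refl
    A-disjoint 0 1 _ x x∈ = P∩Q=∅ x x∈
    A-disjoint 0 2 _ x (x∈P , x∉PQ) = x∉PQ (0 , x∈P)
    A-disjoint 1 0 _ x (x∈Q , x∈P) = P∩Q=∅ x (x∈P , x∈Q)
    A-disjoint 1 1 m≢n x _ = m≢n refl
    A-disjoint 1 2 _ x (x∈Q , x∉PQ) = x∉PQ (1 , x∈Q)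
    A-disjoint 2 0 _ x (x∉PQ , x∈P) = x∉PQ (0 , x∈P)
    A-disjoint 2 1 _ x (x∉PQ , x∈Q) = x∉PQ (1 , x∈Q)
    A-disjoint 2 2 m≢n x _ = m≢n refl
    A-disjoint (suc (suc (suc _))) _ _ x (() , _)
    A-disjoint _ (suc (suc (suc _))) _ x (_ , ())

    A-covers : ⋃ A ≐ whole
    A-covers = (λ _ _ → tt) , λ x _ → covered x
      where
      covered : ∀ x → x ∈ ⋃ A
      covered x with em {P = x ∈ ⋃ PQ}
      ... | yes (zero  , x∈P) = 0 , x∈P
      ... | yes (suc _ , x∈Q) = 1 , x∈Q
      ... | no x∉PQ = 2 , x∉PQ

module _ (𝒴 : ℤ-Space) (M : BorelProbabilityMeasure (space 𝒴)) (inv : InvariantMeasure 𝒴 M) where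
  open ℤ-Space 𝒴 using (Open; open-whole; act) renaming (setoid to Y; space to 𝒴-space)
  open BorelProbabilityMeasure M

  -- By invariance the two series of measures have equal terms. The measure of the union of the
  -- translates bounds the partial sums of the series for `D`, hence also its sum, which is 1.
  translates-full : (D : ℕ → Subset Y) (oD : ∀ n → Open (D n)) (g : ℕ → ℤ) →
    (∀ m n → ¬ m ≡ n → Disjoint (D m) (D n)) →
    (∀ m n → ¬ m ≡ n → Disjoint (image (act (g m)) (D m)) (image (act (g n)) (D n))) →
    whole ⊆ ⋃ D →
    1ᴿ ≤ᴿ μ (⋃ λ n → image (act (g n)) (D n))
            (borel-⋃ λ n → borel-open (image-open 𝒴 (g n) {D n} (oD n)))
  translates-full D oD g D-disjoint gD-disjoint D-covers q 1q =
    proj₂ (μ-additive D bD D-disjoint) (μ (⋃ gD) (borel-⋃ bgD))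
      (λ n q′ → proj₁ (μ-additive gD bgD gD-disjoint) n q′ ∘
        partialSum-mono {λ n → μ (D n) (bD n)} {λ n → μ (gD n) (bgD n)}
          (λ n → proj₂ (inv (g n) (D n) (bD n) (bgD n))) n q′)
      q (proj₁ (μ-cong (borel-open open-whole) (borel-⋃ bD) (D-covers , λ _ _ → tt)) q
          (proj₂ μ-total q 1q))
    where
    gD : ℕ → Subset Y
    gD n = image (act (g n)) (D n)
    bD : ∀ n → Borel 𝒴-space (D n)
    bD n = borel-open (oD n)
    bgD : ∀ n → Borel 𝒴-space (gD n)
    bgD n = borel-open (image-open 𝒴 (g n) {D n} (oD n))

-- Agreement up to a gap

-- The strict bound puts the closing 1 inside the prefix of length `L`, so that this prefix decides
-- the matter.
Seen : ℕ → ℕ → Seq → Set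
Seen n L α = ∃ λ k → n ≤ k × gapEnd k < L × Gap k α

Seen-local : ∀ {n L α β} → α ≈[ L ] β → Seen n L α → Seen n L β
Seen-local h (k , n≤k , e<L , gap) = k , n≤k , e<L , Gap-local k (≈-≤ e<L h) gap

Seen-≤ : ∀ {n L L′ α} → L ≤ L′ → Seen n L α → Seen n L′ α
Seen-≤ L≤L′ (k , n≤k , e<L , gap) = k , n≤k , ℕ.≤-trans e<L L≤L′ , gap

Seen-< : ∀ {n L α} → Seen n L α → n < L
Seen-< (k , n≤k , e<L , _) = ℕ.≤-<-trans n≤k (ℕ.<-trans (k<gapEnd k) e<L)

-- The sequences coincide until a gap of index at least `n` has been seen;
-- such a gap is then seen in both at the same place.
Agree : ℕ → Seq → Seq → Set
Agree n α β = ∀ L → ¬ Seen n L α → α L ≡ β L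

private
  -- Induction on `L`: agreement on the first `L` digits carries `¬ Seen` from `β` back to `α`, and
  -- then `agree` gives the next digit.
  Agree-prefix : ∀ {n α β} → Agree n α β → ∀ L → ¬ Seen n L β → α ≈[ L ] β
  Agree-prefix agree zero    unseen i ()
  Agree-prefix {n} {α} {β} agree (suc L) unseen i (s≤s i≤L) with ℕ.m≤n⇒m<n∨m≡n i≤L
  ... | inj₁ i<L  = Agree-prefix agree L (unseen ∘ Seen-≤ {α = β} (ℕ.n≤1+n L)) i i<L
  ... | inj₂ refl = agree L (unseen ∘ Seen-≤ {α = β} (ℕ.n≤1+n L) ∘ Seen-local
    (Agree-prefix agree L (unseen ∘ Seen-≤ {α = β} (ℕ.n≤1+n L))))

Agree-sym : ∀ {n α β} → Agree n α β → Agree n β α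
Agree-sym agree L unseen =
  sym (agree L (unseen ∘ Seen-local (Agree-prefix agree L unseen)))

Agree-prefixˡ : ∀ {n α β} → Agree n α β → ∀ L → ¬ Seen n L α → α ≈[ L ] β
Agree-prefixˡ {n} {α} {β} agree L unseen =
  ≈-sym (Agree-prefix {n} {β} {α} (Agree-sym {n} {α} {β} agree) L unseen)

-- The first agreement carries `¬ Seen` from `α` to `β`. Transitivity at each fixed `n` makes the
-- distance defined from `Agree` an ultrametric.
Agree-trans : ∀ {n α β γ} → Agree n α β → Agree n β γ → Agree n α γ
Agree-trans {n} {α} {β} agree agree′ L unseen = trans (agree L unseen)
  (agree′ L (unseen ∘ Seen-local (≈-sym (Agree-prefixˡ {n} {α} {β} agree L unseen))))

Agree⇒≈ : ∀ {n α β} → Agree n α β → α ≈[ n ] β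
Agree⇒≈ {n} {α} agree i i<n = agree i λ seen → ℕ.<-asym i<n (Seen-< {α = α} seen)

Agree-antitone : ∀ {m n α β} → m ≤ n → Agree n α β → Agree m α β
Agree-antitone m≤n agree L unseen =
  agree L λ (k , n≤k , rest) → unseen (k , ℕ.≤-trans m≤n n≤k , rest)

-- Once a gap of index at least `n` has been seen, `Agree n` demands nothing more. This makes balls
-- around points of the space open.
GapRich⇒Agree : ∀ {α} → GapRich α → ∀ n → ∃ λ L → ∀ {β} → α ≈[ L ] β → Agree n α β
GapRich⇒Agree rich n = let (k , n≤k , gap) = rich n in
  suc (gapEnd k) , λ h L unseen → h L (ℕ.≰⇒> λ e<L → unseen (k , n≤k , e<L , gap))

-- The radii 1 / (n + 1)

1/1+ : ℕ → ℚ
1/1+ n = ℚ.mkℚ (+ 1) n (1-coprimeTo (suc n))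

0<1/1+ : ∀ n → 0ℚ ℚ.< 1/1+ n
0<1/1+ n = ℚ.positive⁻¹ (1/1+ n)

1/1+-antitone : ∀ {m n} → m ≤ n → 1/1+ n ℚ.≤ 1/1+ m
1/1+-antitone m≤n = ℚ.*≤* (ℤ.*-monoˡ-≤-nonNeg (+ 1) (ℤ.+≤+ (s≤s m≤n)))

1/1+-small : ∀ {r} → 0ℚ ℚ.< r → ∃ λ n → 1/1+ n ℚ.< r
1/1+-small {ℚ.mkℚ (+ zero)   d _} (ℚ.*<* (ℤ.+<+ ()))
1/1+-small {ℚ.mkℚ -[1+ _ ]   d _} (ℚ.*<* ())
-- Here r = (a + 1) / (d + 1), which exceeds 1 / (d + 2).
1/1+-small {ℚ.mkℚ (+ suc a) d _} _ = suc d , ℚ.*<* (ℤ.+<+ (begin-strict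
  suc d ℕ.+ 0         ≡⟨ ℕ.+-identityʳ (suc d) ⟩
  suc d               <⟨ ℕ.≤-refl ⟩
  suc (suc d)         ≤⟨ ℕ.m≤m+n _ _ ⟩
  suc a ℕ.* suc (suc d) ∎))
  where open ℕ.≤-Reasoning

-- The space of sequences with infinitely many gaps

gapSet : Subset (setoid (space Odometer))
gapSet = record
  { mem  = λ (α , _) → GapRich α
  ; resp = λ α≗β → GapRich-∼ (0 , λ i _ → α≗β i)
  }

gapSet-invariant : Invariant Odometer gapSet
gapSet-invariant m (α , o) = GapRich-∼ (∼-sym (actSeq-∼ m α o))

GapSpace : ℤ-Space
GapSpace = restrict Odometer gapSet gapSet-invariant

open ℤ-Space GapSpace using (Point; Open; act; act-+) renaming (setoid to Y; space to 𝒴)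

seq : Point → Seq
seq = proj₁ ∘ proj₁

point : ∀ α → GapRich α → Point
point α rich = (α , GapRich-odometer rich) , rich

∈-resp : (A : Subset Y) → ∀ {x y} → seq x ≗ seq y → x ∈ A → y ∈ A
∈-resp A {x} {y} x≗y = resp A {x} {y} x≗y

Local : Subset Y → Set
Local U = ∀ x → x ∈ U → ∃ λ n → ∀ y → seq x ≈[ n ] seq y → y ∈ U

open⇒local : ∀ {U} → Open U → Local U
open⇒local {U} (V , (V′ , cantorOpen nbhd , V⇔V′) , U⇔V) x x∈U =
  let (n , h) = nbhd (seq x) (Equivalence.to (V⇔V′ _) (Equivalence.to (U⇔V x) x∈U))
  in n , λ y x≈y → Equivalence.from (U⇔V y) (Equivalence.from (V⇔V′ _) (h (seq y) x≈y))

-- An open set of the full Cantor space is required; `near` is the union of the cylinders around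
-- points of `U` whose trace on the space lies in `U`.
local⇒open : ∀ {U} → Local U → Open U
local⇒open {U} local =
  record { mem = λ (α , _) → near α ; resp = near-resp } ,
  (record { mem = near ; resp = near-resp } ,
   cantorOpen (λ α (x , x∈U , n , x≈α , h) →
     n , λ β α≈β → x , x∈U , n , ≈-trans x≈α α≈β , h) ,
   λ _ → mk⇔ id id) ,
  λ x → mk⇔ (λ x∈U → let (n , h) = local x x∈U in x , x∈U , n , (λ _ _ → refl) , h)
            (λ (_ , _ , _ , z≈x , h) → h x z≈x)
  where
  near : Seq → Set
  near α = ∃ λ x → x ∈ U × ∃ λ n → seq x ≈[ n ] α × (∀ y → seq x ≈[ n ] seq y → y ∈ U)
  near-resp : ∀ {α β} → α ≗ β → near α → near β
  near-resp α≗β (x , x∈U , n , x≈α , h) =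
    x , x∈U , n , (λ i i<n → trans (x≈α i i<n) (α≗β i)) , h

cylinder : Point → ℕ → Subset Y
cylinder x n = record
  { mem  = λ y → seq x ≈[ n ] seq y
  ; resp = λ y≗z x≈y i i<n → trans (x≈y i i<n) (y≗z i)
  }

cylinder-open : ∀ x n → Open (cylinder x n)
cylinder-open x n = local⇒open {cylinder x n} λ y x≈y → n , λ z → ≈-trans x≈y

reach : ∀ n (x : Point) (α : Seq) → ∃ λ (m : ℤ) → seq (act m x) ≈[ n ] α
reach n x α = + steps n (seq x) α , steps-reach n (seq x) α

gapSet-Gδ : IsGδ (space Odometer) gapSet
gapSet-Gδ = (λ n → record { mem = λ (α , _) → gapFrom n α ; resp = gapFrom-resp }) ,
  (λ n → record { mem = gapFrom n ; resp = gapFrom-resp } ,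
     cantorOpen (λ α (k , n≤k , gap) →
       suc (gapEnd k) , λ β α≈β → k , n≤k , Gap-local k α≈β gap) ,
     λ _ → mk⇔ id id) ,
  (λ _ → id) , (λ _ → id)
  where
  gapFrom : ℕ → Seq → Set
  gapFrom n α = ∃ λ k → n ≤ k × Gap k α
  gapFrom-resp : ∀ {n α β} → α ≗ β → gapFrom n α → gapFrom n β
  gapFrom-resp α≗β (k , n≤k , gap) = k , n≤k , Gap-local k (≗⇒≈ α≗β) gap

module _ (em : ∀ {ℓ} → ExcludedMiddle ℓ) where

  -- Each 1, at position p, is followed by a gap at p + 1 that ends at the next 1.
  private
    one : ℕ → ℕ
    one zero    = 0
    one (suc k) = gapEnd (suc (one k))

    one-< : ∀ k → one k < one (suc k)
    one-< k = ℕ.<-trans ℕ.≤-refl (k<gapEnd (suc (one k)))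

    one-mono : ∀ {j k} → j ≤ k → one j ≤ one k
    one-mono {k = zero}  z≤n = ℕ.≤-refl
    one-mono {k = suc k} j≤k with ℕ.m≤n⇒m<n∨m≡n j≤k
    ... | inj₁ (s≤s j≤k′) = ℕ.≤-trans (one-mono j≤k′) (ℕ.<⇒≤ (one-< k))
    ... | inj₂ refl       = ℕ.≤-refl

    k≤one : ∀ k → k ≤ one k
    k≤one zero    = z≤n
    k≤one (suc k) = ℕ.≤-<-trans (k≤one k) (one-< k)

    isOne : Seq
    isOne i = does (em {P = ∃ λ j → one j ≡ i})

  examplePoint : Point
  examplePoint = point isOne λ n → suc (one n) , ℕ.m≤n⇒m≤1+n (k≤one n) ,
    (λ i k<i i<e → dec-false em λ (j , eq) → between k<i i<e j eq) ,
    dec-true em (suc n , refl)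
    where
    between : ∀ {n i} → one n < i → i < one (suc n) → ∀ j → ¬ one j ≡ i
    between {n} k<i i<e j refl with j ℕ.≤? n
    ... | yes j≤n = ℕ.<⇒≱ k<i (one-mono j≤n)
    ... | no  j≰n = ℕ.<⇒≱ i<e (one-mono (ℕ.≰⇒> j≰n))

  -- The orbit of a single point already meets every cylinder.
  gapSet-dense : Dense (space Odometer) gapSet
  gapSet-dense (α , o) V (V′ , cantorOpen nbhd , V⇔V′) α∈V =
    let (n , h) = nbhd α (Equivalence.to (V⇔V′ (α , o)) α∈V)
        (m , y≈α) = reach n examplePoint α
        (y , rich) = act m examplePoint
    in y , Equivalence.from (V⇔V′ y) (h (proj₁ y) (≈-sym y≈α)) , rich

  separable : Separable 𝒴
  separable = (λ n → just (act (+ n) examplePoint)) , λ x V oV x∈V →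
    let (n , h) = open⇒local {V} oV x x∈V
        y≈x = steps-reach n (seq examplePoint) (seq x)
        m = steps n (seq examplePoint) (seq x)
    in act (+ m) examplePoint , h _ (≈-sym y≈x) , m , _ , refl , λ _ → refl

  -- Baire category

  private
    escape : ∀ {N} → NowhereDense 𝒴 N → ∀ x n →
      ∃ λ y → seq x ≈[ n ] seq y × ∃ λ m → ∀ z → seq y ≈[ m ] seq z → ¬ z ∈ N
    escape {N} nd x n with em {P = ∃ λ y → seq x ≈[ n ] seq y × ∃ λ m →
                                   ∀ z → seq y ≈[ m ] seq z → ¬ z ∈ N}
    ... | yes esc = esc
    ... | no stuck = ⊥-elim (nd (cylinder x n) (cylinder-open x n) dense (x , λ _ _ → refl))
      where
      dense : ∀ y → y ∈ cylinder x n → Closure 𝒴 N y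
      dense y x≈y V oV y∈V with em {P = Nonempty (V ∩ N)}
      ... | yes meets = meets
      ... | no misses =
        let (m , h) = open⇒local {V} oV y y∈V
        in ⊥-elim (stuck (y , x≈y , m , λ z y≈z z∈N → misses (z , h z y≈z , z∈N)))

  private module Generic (N : ℕ → Subset Y) (nd : ∀ n → NowhereDense 𝒴 (N n)) where

    Stage : Set
    Stage = Point × ℕ

    -- Besides avoiding `N k`, each stage fixes a new gap. The space is not closed in Cantor space,
    -- and these gaps keep the limit inside it.
    refine : ∀ k ((x , n) : Stage) → ∃ λ ((y , m) : Stage) →
      n < m × seq x ≈[ n ] seq y × Seen n m (seq y) × (∀ z → seq y ≈[ m ] seq z → ¬ z ∈ N k)
    refine k (x , n) =
      let (y , x≈y , m , avoid) = escape {N k} (nd k) x n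
          (j , n⊔m≤j , gap) = proj₂ y (n ⊔ m)
          n≤j = ℕ.≤-trans (ℕ.m≤m⊔n n m) n⊔m≤j
          m≤j = ℕ.≤-trans (ℕ.m≤n⊔m n m) n⊔m≤j
          j<l = ℕ.<-trans (k<gapEnd j) ℕ.≤-refl
      in (y , suc (gapEnd j)) , ℕ.≤-<-trans n≤j j<l , x≈y ,
         (j , n≤j , ℕ.≤-refl , gap) ,
         λ z y≈z → avoid z (≈-≤ (ℕ.<⇒≤ (ℕ.≤-<-trans m≤j j<l)) y≈z)

    stage : ℕ → Stage
    stage zero    = examplePoint , 0
    stage (suc k) = proj₁ (refine k (stage k))

    x : ℕ → Seq
    x = seq ∘ proj₁ ∘ stage

    len : ℕ → ℕ
    len = proj₂ ∘ stage

    len-< : ∀ k → len k < len (suc k)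
    len-< k = proj₁ (proj₂ (refine k (stage k)))

    k≤len : ∀ k → k ≤ len k
    k≤len zero    = z≤n
    k≤len (suc k) = ℕ.≤-<-trans (k≤len k) (len-< k)

    coherent : ∀ {j k} → j ≤ k → x j ≈[ len j ] x k × len j ≤ len k
    coherent {k = zero}  z≤n = (λ _ _ → refl) , ℕ.≤-refl
    coherent {k = suc k} j≤k with ℕ.m≤n⇒m<n∨m≡n j≤k
    ... | inj₂ refl = (λ _ _ → refl) , ℕ.≤-refl
    ... | inj₁ (s≤s j≤k′) =
      let (h , le) = coherent j≤k′
      in ≈-trans h (≈-≤ le (proj₁ (proj₂ (proj₂ (refine k (stage k)))))) ,
         ℕ.≤-trans le (ℕ.<⇒≤ (len-< k))

    -- Digit `i` is taken from stage `i + 1`, whose fixed prefix has length at least `i + 1`.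
    limit : Seq
    limit i = x (suc i) i

    limit-≈ : ∀ k → x k ≈[ len k ] limit
    limit-≈ k i i<l with ℕ.≤-total k (suc i)
    ... | inj₁ k≤1+i = proj₁ (coherent k≤1+i) i i<l
    ... | inj₂ 1+i≤k = sym (proj₁ (coherent 1+i≤k) i (k≤len (suc i)))

    limit-rich : GapRich limit
    limit-rich n =
      let seen = proj₁ (proj₂ (proj₂ (proj₂ (refine n (stage n)))))
          (j , len≤j , _ , gap) = Seen-local (limit-≈ (suc n)) seen
      in j , ℕ.≤-trans (k≤len n) len≤j , gap

    generic : Point
    generic = point limit limit-rich

    generic-avoids : ∀ k → ¬ generic ∈ N k
    generic-avoids k = proj₂ (proj₂ (proj₂ (proj₂ (refine k (stage k))))) generic (limit-≈ (suc k))

  category : ∀ {M} → Meager 𝒴 M → ∃ λ x → ¬ x ∈ M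
  category (N , nd , M⊆N , _) = generic , λ x∈M →
    let (n , x∈N) = M⊆N _ x∈M in generic-avoids n x∈N
    where open Generic N nd

  -- For `M` = `A △ U` the orbit obtained meets `A` and `U` in the same points.
  category-saturation : ∀ {M} → Meager 𝒴 M → ∃ λ x → ∀ m → ¬ act m x ∈ M
  category-saturation {M} meager =
    let (x , x∉) = category {saturation GapSpace M} (meager-saturation GapSpace {M} meager)
    in x , λ m mx∈M → x∉ (m , mx∈M)

  △-member : ∀ {A U : Subset Y} {x} → x ∈ U → ¬ x ∈ A △ U → x ∈ A
  △-member {A} {U} {x} x∈U x∉ with em {P = x ∈ A}
  ... | yes x∈A = x∈A
  ... | no x∉A = ⊥-elim (x∉ (inj₂ (x∈U , x∉A)))

  meager⊎nonempty : ∀ A U → Meager 𝒴 (A △ U) → Meager 𝒴 A ⊎ Nonempty U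
  meager⊎nonempty A U meager with em {P = Nonempty U}
  ... | yes nonempty = inj₂ nonempty
  ... | no empty = inj₁ (meager-⊆ 𝒴 {A} {A △ U}
    (λ x x∈A → inj₁ (x∈A , λ x∈U → empty (x , x∈U))) meager)

  -- If `U` is nonempty, each point outside `A` is moved into `U` and by invariance stays outside
  -- `A`. So `∁ A` lies in the saturation of the meager set `A △ U`.
  genericallyErgodic : GenericallyErgodic GapSpace
  genericallyErgodic A inv (U , oU , meager) with meager⊎nonempty A U meager
  ... | inj₁ meagerA = inj₁ meagerA
  ... | inj₂ (u , u∈U) = inj₂ (meager-⊆ 𝒴 {∁ A} {saturation GapSpace (A △ U)}
    (λ x x∉A →
      let (n , h) = open⇒local {U} oU u u∈U
          (m , mx≈u) = reach n x (seq u)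
      in m , inj₂ (h (act m x) (≈-sym mx≈u) , x∉A ∘ invariant-reflect GapSpace {A} inv m x))
    (meager-saturation GapSpace {A △ U} meager))

  -- Weakly wandering sets

  private
    finite-∪ : ∀ {H H₀ H₁ : Pred ℤ 0ℓ} → (∀ h → H h → H₀ h ⊎ H₁ h) →
               Finite H₀ → Finite H₁ → Finite H
    finite-∪ {H} split (l₀ , h₀) (l₁ , h₁) = l₀ ++ l₁ , λ h Hh → included h (split h Hh)
      where
      included : ∀ h → _ → h List.∈ l₀ ++ l₁
      included h (inj₁ Hh) = ∈-++⁺ˡ (h₀ h Hh)
      included h (inj₂ Hh) = ∈-++⁺ʳ l₀ (h₁ h Hh)

    -- Splitting an infinite set of indices by the next digit of `f` leaves at least one infinite
    -- part.
    refineInfinite : (f : ℤ → Seq) {H : Pred ℤ 0ℓ} → ¬ Finite H → ∀ n →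
      ∃ λ (H′ : Pred ℤ 0ℓ) → ¬ Finite H′ × (∀ h → H′ h → H h) ×
        (∀ h h′ → H′ h → H′ h′ → f h ≈[ n ] f h′)
    refineInfinite f {H} inf zero = H , inf , (λ _ → id) , λ _ _ _ _ _ ()
    refineInfinite f {H} inf (suc n) = split
      where
      IH = refineInfinite f {H} inf n
      H′ = proj₁ IH
      part : Bool → Pred ℤ 0ℓ
      part b h = H′ h × f h n ≡ b
      Goal : Set₁
      Goal = ∃ λ (H′ : Pred ℤ 0ℓ) → ¬ Finite H′ × (∀ h → H′ h → H h) ×
        (∀ h h′ → H′ h → H′ h′ → f h ≈[ suc n ] f h′)
      take : ∀ b → ¬ Finite (part b) → Goal
      take b inf′ = part b , inf′ , (λ h (H′h , _) → proj₁ (proj₂ (proj₂ IH)) h H′h) , agree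
        where
        agree : ∀ h h′ → part b h → part b h′ → f h ≈[ suc n ] f h′
        agree h h′ (a , eq) (a′ , eq′) i (s≤s i≤n) with ℕ.m≤n⇒m<n∨m≡n i≤n
        ... | inj₁ i<n  = proj₂ (proj₂ (proj₂ IH)) h h′ a a′ i i<n
        ... | inj₂ refl = trans eq (sym eq′)
      cases : ∀ h → H′ h → part false h ⊎ part true h
      cases h H′h with f h n
      ... | false = inj₁ (H′h , refl)
      ... | true  = inj₂ (H′h , refl)
      split : Goal
      split with em {P = Finite (part false)} | em {P = Finite (part true)}
      ... | no inf₀  | _        = take false inf₀
      ... | _        | no inf₁  = take true inf₁
      ... | yes fin₀ | yes fin₁ = ⊥-elim (proj₁ (proj₂ IH) (finite-∪ cases fin₀ fin₁))

  pigeonhole : (f : ℤ → Seq) {H : Pred ℤ 0ℓ} → ¬ Finite H → ∀ n →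
    ∃ λ h → ∃ λ h′ → H h × H h′ × ¬ h ≡ h′ × f h ≈[ n ] f h′
  pigeonhole f {H} inf n with refineInfinite f {H} inf n
  ... | H′ , inf′ , H′⊆H , agree with em {P = ∃ H′}
  ... | no none = ⊥-elim (inf′ ([] , λ h H′h → ⊥-elim (none (h , H′h))))
  ... | yes (h , H′h) with em {P = ∃ λ h′ → H′ h′ × ¬ h ≡ h′}
  ... | yes (h′ , H′h′ , h≢h′) = h , h′ , H′⊆H h H′h , H′⊆H h′ H′h′ , h≢h′ , agree h h′ H′h H′h′
  ... | no only = ⊥-elim (inf′ (h List.∷ [] , λ h′ H′h′ → here (single h′ H′h′)))
    where
    single : ∀ h′ → H′ h′ → h′ ≡ h
    single h′ H′h′ with em {P = h ≡ h′}
    ... | yes refl = refl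
    ... | no h≢h′  = ⊥-elim (only (h′ , H′h′ , h≢h′))

  -- Two of the points T⁻ʰ x agree on a prefix, so one power Tᵐ takes both
  -- into the open set to which A is equal up to a meager set.
  locallyWeaklyWandering⇒meager : ∀ A → BaireMeasurable 𝒴 A →
    LocallyWeaklyWandering GapSpace A → Meager 𝒴 A
  locallyWeaklyWandering⇒meager A (U , oU , meager) lww with meager⊎nonempty A U meager
  ... | inj₁ meagerA = meagerA
  ... | inj₂ (u , u∈U) =
    let (n , nbhd) = open⇒local {U} oU u u∈U
        (x , generic) = category-saturation {A △ U} meager
        (H , inf , disjoint) = lww x
        (h , h′ , Hh , Hh′ , h≢h′ , agree) =
          pigeonhole (λ h → seq (act (ℤ.- h) x)) {H} inf n
        (m , near) = reach n (act (ℤ.- h) x) (seq u)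
        near′ = ≈-trans (actSeq-local m n (≈-sym agree)) near
        -- T^k (T^(m-k) x) = T^m x does not depend on `k`, so `act m x` is a common point of the
        -- images for `h` and `h′`.
        member : ∀ k → seq (act m (act (ℤ.- k) x)) ≈[ n ] seq u →
                 act m x ∈ image (act k) (A ∩ orbit GapSpace x)
        member k y≈u =
          let y = act m (act (ℤ.- k) x)
              y≡ = act-+ m (ℤ.- k) x
          in y ,
             (△-member {A} {U} {y} (nbhd y (≈-sym y≈u))
               (λ y∈ → generic (m ℤ.+ ℤ.- k) (∈-resp (A △ U) {y} {act (m ℤ.+ ℤ.- k) x}
                  (λ i → sym (y≡ i)) y∈)) ,
              m ℤ.+ ℤ.- k , y≡) ,
             λ i → trans (actSeq-cong k (λ j → sym (y≡ j)) i)
               (trans (sym (act-+ k (m ℤ.+ ℤ.- k) x i))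
                 (cong (λ l → actSeq l (seq x) i) (cancel k m)))
    in ⊥-elim (disjoint h h′ Hh Hh′ h≢h′ (act m x) (member h near , member h′ near′))
    where
    cancel : ∀ k m → k ℤ.+ (m ℤ.+ ℤ.- k) ≡ m
    cancel k m = trans (ℤ.+-comm k _) (trans (ℤ.+-assoc m (ℤ.- k) k)
      (trans (cong (λ l → m ℤ.+ l) (ℤ.+-inverseˡ k)) (ℤ.+-identityʳ m)))

  -- The exceptional set is whichever of `B` and `∁ B` is meager.
  invariant-minority : ∀ B → Invariant GapSpace B → BaireMeasurable 𝒴 B →
    ∃ λ M → Meager 𝒴 M × (∀ x y → ¬ x ∈ M → ¬ y ∈ M → x ∈ B → y ∈ B)
  invariant-minority B inv bm with genericallyErgodic B inv bm
  ... | inj₁ meager   = B , meager , λ x y x∉B _ x∈B → ⊥-elim (x∉B x∈B)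
  ... | inj₂ comeager = ∁ B , comeager , λ x y _ y∉∁B _ → stable y y∉∁B
    where
    stable : ∀ y → ¬ ¬ y ∈ B → y ∈ B
    stable y y∉∁B with em {P = y ∈ B}
    ... | yes y∈B = y∈B
    ... | no y∉B  = ⊥-elim (y∉∁B y∉B)

  completeSection-saturation : ∀ {P W x} → Invariant GapSpace P →
    CompleteSection GapSpace P W → x ∈ P → x ∈ saturation GapSpace W
  completeSection-saturation {P} {W} {x} inv (_ , meets) x∈P =
    let (w , w∈W , m , mx≈w) = meets x λ z (m , mx≈z) →
          ∈-resp P {act m x} {z} mx≈z (inv m x x∈P)
    in m , ∈-resp W {w} {act m x} (sym ∘ mx≈w) w∈W

  weaklyWandering⇒locally : ∀ W → WeaklyWandering GapSpace W → LocallyWeaklyWandering GapSpace W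
  weaklyWandering⇒locally W (H , inf , disj) x = H , inf , λ h h′ Hh Hh′ h≢h′ z
    ((w , (w∈W , _) , eq) , (w′ , (w′∈W , _) , eq′)) →
    disj h h′ Hh Hh′ h≢h′ z ((w , w∈W , eq) , (w′ , w′∈W , eq′))

  -- The points outside the countably many meager sets belong to one piece,
  -- whose section would be meager and hence so would be the whole space.
  no-wandering-partition : ¬ Σ (Partition GapSpace) λ 𝒫 →
      Partition.BaireMeasurablyCountablyGenerated 𝒫
    × (∀ i → Invariant GapSpace (Partition.piece 𝒫 i))
    × (∀ i → ∃ λ W → BaireMeasurable 𝒴 W × WeaklyWandering GapSpace W ×
         CompleteSection GapSpace (Partition.piece 𝒫 i) W)
  no-wandering-partition (𝒫 , (B , bmB , generates) , piece-inv , sections) =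
    contradiction (category {⋃ minority} minorities-meager)
    where
    open Partition 𝒫

    -- A point and its translates share a piece, and the generating sets do not separate points of
    -- one piece.
    B-inv : ∀ n → Invariant GapSpace (B n)
    B-inv n m x x∈B = let (i , x∈i) = cover x in
      Equivalence.to (Equivalence.to (generates x (act m x))
        (i , x∈i , piece-inv i m x x∈i) n) x∈B

    minority : ℕ → Subset Y
    minority n = proj₁ (invariant-minority (B n) (B-inv n) (bmB n))

    minorities-meager : Meager 𝒴 (⋃ minority)
    minorities-meager = meager-⋃ 𝒴 id (λ n → n , refl) {minority}
      λ n → proj₁ (proj₂ (invariant-minority (B n) (B-inv n) (bmB n)))

    samePiece : ∀ x y → ¬ x ∈ ⋃ minority → ¬ y ∈ ⋃ minority → SamePiece x y
    samePiece x y x∉ y∉ = Equivalence.from (generates x y) λ n →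
      let same = proj₂ (proj₂ (invariant-minority (B n) (B-inv n) (bmB n)))
      in mk⇔ (same x y (x∉ ∘ (n ,_)) (y∉ ∘ (n ,_))) (same y x (y∉ ∘ (n ,_)) (x∉ ∘ (n ,_)))

    piece-unique : ∀ i x y → x ∈ piece i → SamePiece x y → y ∈ piece i
    piece-unique i x y x∈i (j , x∈j , y∈j) with em {P = i ≡ j}
    ... | yes refl = y∈j
    ... | no i≢j   = ⊥-elim (disjoint i j i≢j x (x∈i , x∈j))

    contradiction : ¬ ∃ λ x → ¬ x ∈ ⋃ minority
    contradiction (x , x∉) =
      let (i , x∈i) = cover x
          (W , bm , ww , section) = sections i
          W-meager = locallyWeaklyWandering⇒meager W bm (weaklyWandering⇒locally W ww)
      in collapse i x∈i W section W-meager
      where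
      -- A point outside both exceptional sets would lie in the piece of `x`, and its orbit would
      -- miss the section `W`.
      collapse : ∀ i → x ∈ piece i → ∀ W → CompleteSection GapSpace (piece i) W → ¬ Meager 𝒴 W
      collapse i x∈i W section W-meager = outside (category {⋃ exceptional}
          (meager-⋃ 𝒴 (λ { zero → false ; (suc _) → true })
            (λ { false → 0 , refl ; true → 1 , refl }) {exceptional}
            λ { false → minorities-meager ; true → meager-saturation GapSpace {W} W-meager }))
        where
        exceptional : Bool → Subset Y
        exceptional false = ⋃ minority
        exceptional true  = saturation GapSpace W

        outside : ¬ ∃ λ y → ¬ y ∈ ⋃ exceptional
        outside (y , y∉) = y∉ (true , completeSection-saturation {piece i} {W} {y} (piece-inv i)
          section (piece-unique i x y x∈i (samePiece x y x∉ (y∉ ∘ (false ,_)))))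
  -- A complete metric

  stepBelow : Point → Point → ℕ → ℚ → Set
  stepBelow x y n q = ¬ Agree n (seq x) (seq y) × q ℚ.< 1/1+ n

  -- The distance is the supremum of 1 / (n + 1) over the n for which x and
  -- y do not agree up to a gap of index at least n.
  dist : Point → Point → ℝ≥0
  dist x y = record
    { below    = λ q → q ℚ.< 0ℚ ⊎ ∃ λ n → stepBelow x y n q
    ; negative = inj₁
    ; down     = λ where
        p<q (inj₁ q<0)          → inj₁ (ℚ.<-trans p<q q<0)
        p<q (inj₂ (n , ¬a , q<)) → inj₂ (n , ¬a , ℚ.<-trans p<q q<)
    ; open-up  = λ where
        (inj₁ q<0)           → let (r , q<r , r<0) = ℚ.<-dense q<0 in r , q<r , inj₁ r<0
        (inj₂ (n , ¬a , q<)) → let (r , q<r , r<) = ℚ.<-dense q< in r , q<r , inj₂ (n , ¬a , r<)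
    ; bounded  = 1/1+ 0 , λ where
        (inj₁ q<0)          → ℚ.<-trans q<0 (0<1/1+ 0)
        (inj₂ (n , _ , q<)) → ℚ.<-≤-trans q< (1/1+-antitone z≤n)
    }

  private
    dist-≤ : ∀ {x y x′ y′} →
      (∀ n → Agree n (seq x′) (seq y′) → Agree n (seq x) (seq y)) → dist x y ≤ᴿ dist x′ y′
    dist-≤ imp q (inj₁ q<0)          = inj₁ q<0
    dist-≤ imp q (inj₂ (n , ¬a , q<)) = inj₂ (n , ¬a ∘ imp n , q<)

  ≤ᴿ-+ˡ : ∀ x y → x ≤ᴿ x +ᴿ y
  ≤ᴿ-+ˡ x y q xq =
    let (r , q<r , xr) = ℝ≥0.open-up x xq
    -- q = r + (q - r), where q - r is negative and hence below `y`.
    in r , q ℚ.- r , xr ,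
       ℝ≥0.negative y (subst (q ℚ.- r ℚ.<_) (ℚ.+-inverseʳ r) (ℚ.+-monoˡ-< (ℚ.- r) q<r)) ,
       trans (ℚ.+-comm r (q ℚ.- r)) (trans (ℚ.+-assoc q (ℚ.- r) r)
         (trans (cong (q ℚ.+_) (ℚ.+-inverseˡ r)) (ℚ.+-identityʳ q)))

  ≤ᴿ-+ʳ : ∀ x y → y ≤ᴿ x +ᴿ y
  ≤ᴿ-+ʳ x y q yq =
    let (a , b , ya , xb , eq) = ≤ᴿ-+ˡ y x q yq in b , a , xb , ya , trans (ℚ.+-comm b a) eq

  dist-triangle : ∀ x y z → dist x z ≤ᴿ dist x y +ᴿ dist y z
  dist-triangle x y z q (inj₁ q<0) = ≤ᴿ-+ˡ (dist x y) (dist y z) q (inj₁ q<0)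
  dist-triangle x y z q (inj₂ (n , ¬a , q<)) with em {P = Agree n (seq x) (seq y)}
  ... | no ¬xy = ≤ᴿ-+ˡ (dist x y) (dist y z) q (inj₂ (n , ¬xy , q<))
  ... | yes xy = ≤ᴿ-+ʳ (dist x y) (dist y z) q
    (inj₂ (n , ¬a ∘ Agree-trans {n} {seq x} {seq y} {seq z} xy , q<))

  ≗⇒Agree : ∀ {n α β} → α ≗ β → Agree n α β
  ≗⇒Agree h L _ = h L

  metric : Metric 𝒴
  metric = record
    { d          = dist
    ; d-cong     = λ {x} {x′} {y} {y′} x≗x′ y≗y′ →
        dist-≤ {x} {y} {x′} {y′} (λ n a →
          Agree-trans {n} {seq x} {seq x′} {seq y} (≗⇒Agree x≗x′)
            (Agree-trans {n} {seq x′} {seq y′} {seq y} a (≗⇒Agree (sym ∘ y≗y′)))) ,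
        dist-≤ {x′} {y′} {x} {y} (λ n a →
          Agree-trans {n} {seq x′} {seq x} {seq y′} (≗⇒Agree (sym ∘ x≗x′))
            (Agree-trans {n} {seq x} {seq y} {seq y′} a (≗⇒Agree y≗y′)))
    ; d-zero     = λ {x} {y} → mk⇔ (zero⇒≈ x y) (≈⇒zero x y)
    ; d-sym      = λ x y →
        dist-≤ {x} {y} {y} {x} (λ n → Agree-sym {n} {seq y} {seq x}) ,
        dist-≤ {y} {x} {x} {y} (λ n → Agree-sym {n} {seq x} {seq y})
    ; d-triangle = dist-triangle
    }
    where
    zero⇒≈ : ∀ x y → dist x y ≃ᴿ 0ᴿ → seq x ≗ seq y
    zero⇒≈ x y (d≤0 , _) i with em {P = Agree (suc i) (seq x) (seq y)}
    ... | yes a = Agree⇒≈ {suc i} {seq x} {seq y} a i ℕ.≤-refl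
    ... | no ¬a = ⊥-elim (ℚ.<-irrefl refl (d≤0 0ℚ (inj₂ (suc i , ¬a , 0<1/1+ (suc i)))))
    ≈⇒zero : ∀ x y → seq x ≗ seq y → dist x y ≃ᴿ 0ᴿ
    ≈⇒zero x y x≗y = to , λ q → inj₁
      where
      to : dist x y ≤ᴿ 0ᴿ
      to q (inj₁ q<0) = q<0
      to q (inj₂ (n , ¬a , _)) = ⊥-elim (¬a (≗⇒Agree x≗y))

  radius : ℕ → ℝ≥0
  radius n = fromℚ (1/1+ n) (ℚ.<⇒≤ (0<1/1+ n))

  0<radius : ∀ n → 0ᴿ <ᴿ radius n
  0<radius n = 0ℚ , 0<1/1+ n , ℚ.<-irrefl refl

  close⇒Agree : ∀ n x y → dist x y <ᴿ radius n → Agree n (seq x) (seq y)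
  close⇒Agree n x y (q , q< , ¬below) with em {P = Agree n (seq x) (seq y)}
  ... | yes a = a
  ... | no ¬a = ⊥-elim (¬below (inj₂ (n , ¬a , q<)))

  Agree⇒close : ∀ ε → 0ᴿ <ᴿ ε → ∃ λ n → ∀ x y → Agree n (seq x) (seq y) → dist x y <ᴿ ε
  Agree⇒close ε (q , εq , q≮0) =
    -- As `q` may be 0, a larger rational below `ε` serves as the positive bound.
    let (r , q<r , εr) = ℝ≥0.open-up ε εq
        0<r = ℚ.≤-<-trans (ℚ.≮⇒≥ q≮0) q<r
        (n , 1/1+n<r) = 1/1+-small 0<r
    in n , λ x y a → r , εr , λ where
         (inj₁ r<0) → ℚ.<-asym 0<r r<0
         -- From 1 / (n + 1) < r < 1 / (k + 1) follows k ≤ n, so agreement at `n` includes agreement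
         -- at `k`.
         (inj₂ (k , ¬a , r<)) → ¬a (Agree-antitone {k} {n} {seq x} {seq y}
           (ℕ.≮⇒≥ λ n<k → ℚ.<-asym (ℚ.<-≤-trans r< (1/1+-antitone (ℕ.<⇒≤ n<k))) 1/1+n<r) a)

  compatible : Metric.Compatible metric
  compatible U = mk⇔
    (λ oU x x∈U →
      let (n , h) = open⇒local {U} oU x x∈U
      in radius n , 0<radius n , λ y x~y → h y (Agree⇒≈ {n} {seq x} {seq y} (close⇒Agree n x y x~y)))
    (λ balls → local⇒open {U} λ x x∈U →
      let (ε , 0<ε , ball) = balls x x∈U
          (n , agree⇒close) = Agree⇒close ε 0<ε
          (L , prefix⇒agree) = GapRich⇒Agree {seq x} (proj₂ x) n
      in L , λ y x≈y → ball y (agree⇒close x y (prefix⇒agree x≈y)))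

  complete : Metric.Complete metric
  complete s cauchy = limit , λ ε 0<ε →
    let (n , agree⇒close) = Agree⇒close ε 0<ε
    in N n , λ m N≤m → agree⇒close (s m) limit (limit-agree n m N≤m)
    where
    N : ℕ → ℕ
    N n = proj₁ (cauchy (radius n) (0<radius n))

    agree : ∀ n {l m} → N n ≤ l → N n ≤ m → Agree n (seq (s l)) (seq (s m))
    agree n {l} {m} N≤l N≤m = close⇒Agree n (s l) (s m)
      (proj₂ (cauchy (radius n) (0<radius n)) l m N≤l N≤m)

    α : Seq
    α i = seq (s (N (suc i))) i

    α-agree : ∀ n m → N n ≤ m → Agree n (seq (s m)) α
    α-agree n m N≤m L unseen =
      let l = N n ⊔ N (suc L)
      in trans (agree n {m} {l} N≤m (ℕ.m≤m⊔n (N n) (N (suc L))) L unseen)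
           (sym (Agree⇒≈ {suc L} {α = seq (s (N (suc L)))} {seq (s l)}
             (agree (suc L) ℕ.≤-refl (ℕ.m≤n⊔m (N n) (N (suc L)))) L ℕ.≤-refl))

    -- If the limit had no gap of index at least `n`, its agreement with `s (N n)` would never be
    -- released and would copy a gap of that term.
    α-rich : GapRich α
    α-rich n with em {P = ∃ λ k → n ≤ k × Gap k α}
    ... | yes gap = gap
    ... | no none =
      let x = seq (s (N n))
          (k , n≤k , gap) = proj₂ (s (N n)) n
          α≈x = Agree-prefixˡ {n} {α} {x} (Agree-sym {n} {x} {α} (α-agree n (N n) ℕ.≤-refl))
                  (suc (gapEnd k)) λ (j , n≤j , _ , gap) → none (j , n≤j , gap)
      in ⊥-elim (none (k , n≤k , Gap-local k (≈-sym α≈x) gap))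

    limit : Point
    limit = point α α-rich

    limit-agree : ∀ n m → N n ≤ m → Agree n (seq (s m)) (seq limit)
    limit-agree = α-agree

  polish : IsPolish 𝒴
  polish = separable , metric , compatible , complete

  -- Two disjoint copies of the space

  -- Choosing the first gap makes `k` a function of the sequence, whence the pieces are disjoint.
  FirstGap : ℕ → Seq → Set
  FirstGap k α = Gap k α × (∀ j → j < k → ¬ Gap j α)

  FirstGap-unique : ∀ {j k α} → FirstGap j α → FirstGap k α → j ≡ k
  FirstGap-unique {j} {k} (gap , first) (gap′ , first′) with ℕ.<-cmp j k
  ... | tri< j<k _ _ = ⊥-elim (first′ j j<k gap)
  ... | tri≈ _ j≡k _ = j≡k
  ... | tri> _ _ k<j = ⊥-elim (first k k<j gap′)

  -- Gaps of smaller index end no later, so the same prefix decides them.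
  FirstGap-local : ∀ {k α β} → α ≈[ suc (gapEnd k) ] β → FirstGap k α → FirstGap k β
  FirstGap-local {k} h (gap , first) = Gap-local k h gap , λ j j<k gap′ →
    first j j<k (Gap-local j (≈-sym (≈-≤ (s≤s (gapEnd-mono (ℕ.<⇒≤ j<k))) h)) gap′)

  FirstGap-exists : ∀ {α} k → Gap k α → ∃ λ j → FirstGap j α
  FirstGap-exists {α} = <-rec (λ k → Gap k α → ∃ λ j → FirstGap j α) search
    where
    search : ∀ k → (∀ {j} → j < k → Gap j α → ∃ λ j → FirstGap j α) →
             Gap k α → ∃ λ j → FirstGap j α
    search k rec gap with em {P = ∃ λ j → j < k × Gap j α}
    ... | yes (j , j<k , gap′) = rec j<k gap′
    ... | no none = k , gap , λ j j<k gap′ → none (j , j<k , gap′)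

  -- Of `code k c α` only the first `gapEnd k` digits are aimed at, that is the header and `k`
  -- digits of `α`.
  codeSteps : Bool → ℕ → Seq → ℕ
  codeSteps c k α = steps (gapEnd k) α (code k c α)

  codeSteps-local : ∀ c k {α β} → α ≈[ gapEnd k ] β → codeSteps c k α ≡ codeSteps c k β
  codeSteps-local c k h = steps-local (gapEnd k) h (code-local k c h)

  -- The set on which the copy with label c is the translation by m.
  copyPiece : Bool → ℕ → Subset Y
  copyPiece c m = record
    { mem  = λ x → ∃ λ k → FirstGap k (seq x) × codeSteps c k (seq x) ≡ m
    ; resp = λ x≗y (k , first , eq) →
        k , FirstGap-local {k} (λ i _ → x≗y i) first ,
        trans (sym (codeSteps-local c k (λ i _ → x≗y i))) eq
    }

  copyPiece-open : ∀ c m → Open (copyPiece c m)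
  copyPiece-open c m = local⇒open {copyPiece c m} λ x (k , first , eq) →
    suc (gapEnd k) , λ y x≈y → k , FirstGap-local {k} x≈y first ,
      trans (sym (codeSteps-local c k (≈-≤ (ℕ.n≤1+n _) x≈y))) eq

  copyPiece-disjoint : ∀ c m n → ¬ m ≡ n → Disjoint (copyPiece c m) (copyPiece c n)
  copyPiece-disjoint c m n m≢n x ((k , first , eq) , (k′ , first′ , eq′))
    with refl ← FirstGap-unique {α = seq x} first first′ = m≢n (trans (sym eq) eq′)

  copyPiece-covers : ∀ c → whole ⊆ ⋃ (copyPiece c)
  copyPiece-covers c x _ =
    let (j , _ , gap) = proj₂ x 0
        (k , first) = FirstGap-exists j gap
    in codeSteps c k (seq x) , k , first , refl

  copy : Bool → Subset Y
  copy c = ⋃ λ m → image (act (+ m)) (copyPiece c m)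

  -- Decoding `y` gives k = k′, c = c′ and the first `k` digits of `x` and `x′`; the gaps extend
  -- this agreement to the prefix that determines the number of steps.
  copy-label : ∀ {c c′ m m′ y} → y ∈ image (act (+ m)) (copyPiece c m) →
    y ∈ image (act (+ m′)) (copyPiece c′ m′) → c ≡ c′ × m ≡ m′
  copy-label {c} {c′} {y = y} (x , (k , (gap , _) , refl) , mx≈y) (x′ , (k′ , (gap′ , _) , refl) , mx′≈y)
    with code-injective k k′ k k′ {c} {c′} {seq x} {seq x′} (λ i i<e i<e′ →
           trans (sym (steps-reach (gapEnd k) (seq x) (code k c (seq x)) i i<e))
             (trans (mx≈y i) (trans (sym (mx′≈y i))
               (steps-reach (gapEnd k′) (seq x′) (code k′ c′ (seq x′)) i i<e′))))
  ... | refl , refl , x≈x′ = refl , codeSteps-local c k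
    (≈-≤ (ℕ.n≤1+n _) (Gap-determined k (λ j j<k → x≈x′ j j<k j<k) gap gap′))

  no-invariant-measure : ¬ Σ (BorelProbabilityMeasure 𝒴) λ M → InvariantMeasure GapSpace M
  no-invariant-measure (M , inv) = no-disjoint-full em 𝒴 M (copy-borel false) (copy-borel true)
    (λ y ((m , y∈) , (m′ , y∈′)) → false≢true (proj₁ (copy-label {m = m} {m′} {y} y∈ y∈′)))
    (copy-full false) (copy-full true)
    where
    open BorelProbabilityMeasure M
    copy-borel : ∀ c → Borel 𝒴 (copy c)
    copy-borel c = borel-⋃ λ m → borel-open (image-open GapSpace (+ m) {copyPiece c m} (copyPiece-open c m))
    copy-full : ∀ c → 1ᴿ ≤ᴿ μ (copy c) (copy-borel c)
    copy-full c = translates-full GapSpace M inv (copyPiece c) (copyPiece-open c) +_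
      (copyPiece-disjoint c)
      (λ m n m≢n y (y∈ , y∈′) → m≢n (proj₂ (copy-label {c} {c} {m} {n} {y} y∈ y∈′)))
      (copyPiece-covers c)
    false≢true : ¬ false ≡ true
    false≢true ()

corollary11p11 : (∀ {ℓ} → ExcludedMiddle ℓ) →
  Σ (Subset (setoid (space Odometer))) λ Yset →
  Σ (Invariant Odometer Yset) λ inv →
  let Y = restrict Odometer Yset inv in
    Dense (space Odometer) Yset
  × IsGδ (space Odometer) Yset
  × IsPolish (space Y)
  × GenericallyErgodic Y
  × (¬ Σ (BorelProbabilityMeasure (space Y)) λ M → InvariantMeasure Y M)
  × (¬ ∃ λ A → ¬ Meager (space Y) A × BaireMeasurable (space Y) A × LocallyWeaklyWandering Y A)
  × (¬ Σ (Partition Y) λ 𝒫 →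
        Partition.BaireMeasurablyCountablyGenerated 𝒫
      × (∀ i → Invariant Y (Partition.piece 𝒫 i))
      × (∀ i → ∃ λ W → BaireMeasurable (space Y) W × WeaklyWandering Y W × CompleteSection Y (Partition.piece 𝒫 i) W))
corollary11p11 em =
  gapSet , gapSet-invariant , gapSet-dense em , gapSet-Gδ , polish em , genericallyErgodic em ,
  no-invariant-measure em ,
  (λ (A , nonmeager , bm , lww) → nonmeager (locallyWeaklyWandering⇒meager em A bm lww)) ,
  no-wandering-partition em
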